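{- Let $n>c_1\ge c_2$ be positive integers and let $\Sigma$ be an even positive integer with $nc_1\ge\Sigma\ge nc_2$. If the simple degree sequence region $\mathbb D(n,\Sigma,c_1,c_2)$ is fully graphic, then $\partial^{++}(D)\le 3\cdot n^{13}$ for each $D\in\mathbb D(n,\Sigma,c_1,c_2)$.
   Context: A degree sequence of length $n$ is a sequence $D=(d_1,\dots,d_n)$ of positive integers, each at most $n-1$, with even sum. It is graphic if there is a simple graph on vertex set $\{1,\dots,n\}$ in which vertex $i$ has degree $d_i$ for every $i$; such a graph is called a realization of $D$. $\mathcal G(D)$ denotes the set of all (labelled) realizations of $D$; it is empty if $D$ (an arbitrary integer vector) has no realization. For positive integers $n>c_1\ge c_2$ and even $\Sigma$, $\mathbb D(n,\Sigma,c_1,c_2)$ is the set of all degree sequences $(d_1,\dots,d_n)$ of length $n$ with $c_1\ge d_i\ge c_2$ for all $i$ and $\sum_i d_i=\Sigma$. A set of degree sequences is fully graphic if every element of it is graphic. For $1\le i,j\le n$, $1^{+i}_{+j}$ denotes the integer vector $e_i+e_j$ of length $n$, where $e_i$ is the $i$th standard unit vector. For a graphic degree sequence $D$ of length $n$, $$\partial^{++}(D)=\sum_{1\le i<j\le n}\frac{|\mathcal G(D+1^{+i}_{+j})|}{|\mathcal G(D)|}.$$ -}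

module Defs where

open import Data.Bool using (if_then_else_)
open import Data.Fin using (Fin; _<?_; _≟_)
open import Data.Fin.Properties using (all?)
open import Data.Fin.Subset using (Subset; inside; outside; ∣_∣; _∉_)
  renaming (_∈_ to _∈ˢ_)
open import Data.Fin.Subset.Properties using (_∈?_)
open import Data.Integer using (+_)
open import Data.List using (List; []; _∷_; filter; length; cartesianProductWith)
open import Data.List.Membership.Propositional using (_∈_)
open import Data.List.Membership.Propositional.Properties
  using (∈-cartesianProductWith⁺; ∈-filter⁺; ∈-filter⁻; ∈-length)
open import Data.List.Relation.Unary.All using ([]; _∷_)
open import Data.List.Relation.Unary.AllPairs using ([]; _∷_)
open import Data.List.Relation.Unary.Any using (here; there)
open import Data.List.Relation.Unary.Unique.Propositional using (Unique)
import Data.List.Relation.Unary.Unique.Propositional.Properties as Unique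
open import Data.Nat using (ℕ; zero; suc; _+_; _∸_; _≤_; _<_; NonZero; >-nonZero)
import Data.Nat.Properties as ℕ
open import Data.Nat.Divisibility using (_∣_)
open import Data.Product using (∃; _×_; _,_; proj₂)
open import Data.Rational using (ℚ; 0ℚ; _/_)
import Data.Rational.Properties as ℚ
open import Data.Vec using (Vec; []; _∷_; lookup)
open import Data.Vec.Properties using (∷-injective)
open import Data.Vec.Functional using (Vector; zipWith)
import Algebra.Properties.Monoid.Sum as Sum
open import Level using (0ℓ)
open import Relation.Binary.PropositionalEquality using (_≡_; refl)
open import Relation.Nullary using (does)
open import Relation.Nullary.Decidable using (map′; ¬?; _×-dec_; _→-dec_)
open import Relation.Unary using (Pred; Decidable)
  renaming (_∈_ to _∈ᵖ_)

open Sum ℕ.+-0-monoid using () renaming (sum to sumℕ) public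
open Sum ℚ.+-0-monoid using () renaming (sum to sumℚ) public

-- A family of neighbourhoods, one for each vertex (equivalently, the rows of a
-- 0/1 adjacency matrix). `Vec` rather than a function, so that `_≡_` identifies
-- exactly the equal labelled graphs and counting up to `_≡_` is meaningful.

Neighbourhoods : ℕ → Set
Neighbourhoods n = Vec (Subset n) n

module _ {n : ℕ} where

  record IsSimpleGraph (G : Neighbourhoods n) : Set where
    constructor mkSimple
    field
      symmetric   : ∀ i j → j ∈ˢ lookup G i → i ∈ˢ lookup G j
      irreflexive : ∀ i → i ∉ lookup G i

  degree : Neighbourhoods n → Fin n → ℕ
  degree G i = ∣ lookup G i ∣

  record IsRealization (D : Vector ℕ n) (G : Neighbourhoods n) : Set where
    constructor mkRealization
    field
      isSimpleGraph : IsSimpleGraph G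
      degrees       : ∀ i → degree G i ≡ D i

  Graphic : Pred (Vector ℕ n) 0ℓ
  Graphic D = ∃ λ G → IsRealization D G

  FullyGraphic : Pred (Vector ℕ n) 0ℓ → Set
  FullyGraphic P = ∀ D → D ∈ᵖ P → Graphic D

  record IsDegreeSequence (D : Vector ℕ n) : Set where
    field
      positive : ∀ i → 0 < D i
      bounded  : ∀ i → D i ≤ n ∸ 1
      even     : 2 ∣ sumℕ D

record 𝔻 (n Σ c₁ c₂ : ℕ) (D : Vector ℕ n) : Set where
  field
    isDegreeSequence : IsDegreeSequence D
    upper            : ∀ i → D i ≤ c₁
    lower            : ∀ i → c₂ ≤ D i
    total            : sumℕ D ≡ Σ

isSimpleGraph? : ∀ {n} → Decidable (IsSimpleGraph {n})
isSimpleGraph? G =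
  map′ (λ (s , r) → mkSimple s r) (λ (mkSimple s r) → s , r)
    (all? (λ i → all? (λ j → (j ∈? lookup G i) →-dec (i ∈? lookup G j)))
      ×-dec all? (λ i → ¬? (i ∈? lookup G i)))

isRealization? : ∀ {n} (D : Vector ℕ n) → Decidable (IsRealization D)
isRealization? D G =
  map′ (λ (s , d) → mkRealization s d) (λ (mkRealization s d) → s , d)
    (isSimpleGraph? G ×-dec all? (λ i → degree G i ℕ.≟ D i))

module _ {A : Set} (xs : List A) where

  allVecs : ∀ m → List (Vec A m)
  allVecs zero    = [] ∷ []
  allVecs (suc m) = cartesianProductWith _∷_ xs (allVecs m)

  allVecs-complete : (∀ x → x ∈ xs) → ∀ {m} (v : Vec A m) → v ∈ allVecs m
  allVecs-complete all []      = here refl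
  allVecs-complete all (x ∷ v) =
    ∈-cartesianProductWith⁺ _∷_ (all x) (allVecs-complete all v)

  allVecs-unique : Unique xs → ∀ m → Unique (allVecs m)
  allVecs-unique uniq zero    = [] ∷ []
  allVecs-unique uniq (suc m) =
    Unique.cartesianProductWith⁺ _∷_ ∷-injective uniq (allVecs-unique uniq m)

allSubsets : ∀ n → List (Subset n)
allSubsets = allVecs (outside ∷ inside ∷ [])

allSubsets-complete : ∀ {n} (p : Subset n) → p ∈ allSubsets n
allSubsets-complete =
  allVecs-complete _ λ { outside → here refl ; inside → there (here refl) }

allSubsets-unique : ∀ n → Unique (allSubsets n)
allSubsets-unique = allVecs-unique _ (((λ ()) ∷ []) ∷ [] ∷ [])

allNeighbourhoods : ∀ n → List (Neighbourhoods n)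
allNeighbourhoods n = allVecs (allSubsets n) n

module _ {n : ℕ} (D : Vector ℕ n) where

  -- The three lemmas below show that this list contains each realization of D
  -- exactly once and nothing else.
  𝓖 : List (Neighbourhoods n)
  𝓖 = filter (isRealization? D) (allNeighbourhoods n)

  𝓖-complete : ∀ {G} → IsRealization D G → G ∈ 𝓖
  𝓖-complete =
    ∈-filter⁺ (isRealization? D) (allVecs-complete _ allSubsets-complete _)

  𝓖-sound : ∀ {G} → G ∈ 𝓖 → IsRealization D G
  𝓖-sound G∈𝓖 =
    proj₂ (∈-filter⁻ (isRealization? D) {xs = allNeighbourhoods n} G∈𝓖)

  𝓖-unique : Unique 𝓖
  𝓖-unique =
    Unique.filter⁺ (isRealization? D) (allVecs-unique _ (allSubsets-unique n) n)

  ∣𝓖∣ : ℕ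
  ∣𝓖∣ = length 𝓖

  graphic⇒∣𝓖∣≢0 : Graphic D → NonZero ∣𝓖∣
  graphic⇒∣𝓖∣≢0 (_ , r) = >-nonZero (∈-length (𝓖-complete r))

module _ {n : ℕ} where

  infixl 6 _⊕_

  _⊕_ : Vector ℕ n → Vector ℕ n → Vector ℕ n
  _⊕_ = zipWith _+_

  e : Fin n → Vector ℕ n
  e i k = if does (i ≟ k) then 1 else 0

  1⁺⁺ : Fin n → Fin n → Vector ℕ n
  1⁺⁺ i j = e i ⊕ e j

  -- The proof of graphicness only serves to make the denominator nonzero.
  ∂⁺⁺ : (D : Vector ℕ n) → .(Graphic D) → ℚ
  ∂⁺⁺ D g = sumℚ λ i → sumℚ λ j → if does (i <? j) then ratio i j else 0ℚ
    where
    ratio : Fin n → Fin n → ℚ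
    ratio i j = _/_ (+ ∣𝓖∣ (D ⊕ 1⁺⁺ i j)) (∣𝓖∣ D) {{graphic⇒∣𝓖∣≢0 D g}}

{-# OPTIONS --safe #-}

-- Let H realize D + e_p + e_q with D(p) ≤ D(q). Unless p ~ q, either some
-- s ∈ N(q) ∖ N(p) allows replacing qs by sp, which moves the surplus of q to p, or
-- N(p) = N(q). So assume N(p) = N(q) =: A, where p = q is allowed. If an alternating
-- trail of length at most 11 leads from p to q, starting and ending with an edge,
-- then toggling it yields a realization of D, and H is recovered from that
-- realization and at most 13 vertices, p and q included.
--
-- If there is no such trail, the vertices split into a clique U (reached by short
-- trails ending with an edge), an independent set W (reached by short trails ending
-- with a non-edge) and a rest R that is completely joined to U and almost detached
-- from B ⊆ W. Here p, q ∈ B, so D satisfies the Erdős–Gallai inequality for (U, W)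
-- with next to no slack. Then the sequence (c₁, …, c₁, x, c₂, …, c₂) with sum Σ
-- violates the Erdős–Gallai condition for one of the partitions U | R ∪ W,
-- U ∪ R | W, or for the pair (U, W), so the region is not fully graphic.

module Submission where

open import Defs
open import Data.Bool using (Bool; true; false; not; _xor_; if_then_else_)
import Data.Bool as Bool
open import Data.Bool.Properties using (xor-assoc; xor-same; xor-identityʳ)
open import Data.Empty using (⊥; ⊥-elim)
open import Data.Fin using (Fin; zero; suc; toℕ; _≟_)
open import Data.Fin.Properties using (any?; all?; injective⇒≤)
import Data.Fin.Properties as Fin
open import Data.Fin.Subset using (Subset; inside; outside; ∣_∣)
open import Data.Integer using (+_)
import Data.Integer as ℤ
import Data.Integer.Properties as ℤ
open import Data.List using (List; []; _∷_; _++_; length; map; cartesianProductWith; allFin)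
import Data.List as List
open import Data.List.Properties using (length-map; length-++; length-tabulate)
open import Data.List.Membership.Propositional using (_∈_; lose)
open import Data.List.Membership.Propositional.Properties
  using (∈-cartesianProductWith⁺; ∈-++⁺ˡ; ∈-++⁺ʳ; ∈-map⁺; ∈-allFin; ∈-lookup)
open import Data.List.Membership.Setoid.Properties using (index-injective)
open import Data.List.Relation.Unary.All using (All; []; _∷_)
import Data.List.Relation.Unary.All as All
open import Data.List.Relation.Unary.AllPairs using (_∷_)
open import Data.List.Relation.Unary.Any using (index)
open import Data.List.Relation.Unary.Any.Properties using (lookup-result)
import Data.List.Relation.Unary.Any as Any
open import Data.List.Relation.Unary.Unique.Propositional using (Unique)
open import Data.Nat using (ℕ; zero; suc; _+_; _*_; _∸_; _^_; _⊓_; _≤_; _<_; _<ᵇ_; _<?_; NonZero; >-nonZero; z≤n; s≤s; z<s)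
import Data.Nat as ℕ
open import Data.Nat.Divisibility using (_∣_)
open import Data.Nat.Properties hiding (_≟_; _<?_)
open import Data.Nat.Tactic.RingSolver using (solve-∀)
open import Data.Product using (∃; _×_; _,_; proj₁; proj₂)
open import Data.Rational using (ℚ; 0ℚ; _/_; toℚᵘ) renaming (_≤_ to _≤ℚ_; _+_ to _+ℚ_)
import Data.Rational.Properties as ℚ
open import Data.Rational.Unnormalised using (mkℚᵘ; *≤*; *≡*) renaming (_+_ to _+ᵘ_)
import Data.Rational.Unnormalised.Properties as ℚᵘ
open import Data.Sum using (_⊎_; inj₁; inj₂)
import Data.Sum as Sum
open import Data.Vec using (Vec; []; _∷_; lookup; tabulate)
open import Data.Vec.Properties using (lookup∘tabulate; lookup⇒[]=; []=⇒lookup; tabulate∘lookup; tabulate-cong)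
open import Data.Vec.Functional using (Vector)
open import Function using (_∘_)
open import Relation.Binary.PropositionalEquality
open import Relation.Nullary using (Dec; yes; no; does; ¬_; contradiction)
open import Relation.Nullary.Decidable using (_×-dec_; _⊎-dec_; _→-dec_; dec-true; dec-false; ¬?)
open import Algebra.Properties.Semiring.Sum +-*-semiring
  using (∑-distrib-+; ∑-comm; sum-cong-≗; sum-replicate-zero; *-distribˡ-sum; *-distribʳ-sum)

-- The obstacle is that an alternating walk from p to q is of no use if it repeats a pair, because
-- the second toggle undoes the first. Hence every trail is assembled from two root trails of length
-- 1 or 3, starting at p and at q, and a middle trail of length 1, 3 or 5 that joins their ends;
-- this gives 3 + 5 + 3 = 11. Membership in U outside A demands two routes, so that the second root
-- trail can avoid the first. One defect remains, the blossom: a vertex t of U that cannot serve as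
-- the end of both root trails, with an edge whose two ends miss only t within U. A middle trail of
-- length 5 through the edges of two blossoms shows that there is at most one. It is moved to R, at
-- the price of at most one edge between B and R, and the counts can afford that edge because p and
-- q carry two surplus units.
--
-- Ten vertices describe a padded trail and s is an eleventh, so every pair p, q costs a factor n^10
-- + n^11. Bounding all n^2 pairs gives n^12 + n^13, at most 2n^13, which leaves room below 3n^13.

private variable
  n : ℕ

-- Finite sums

⟦_⟧ : Bool → ℕ
⟦ true ⟧  = 1
⟦ false ⟧ = 0

⟦⟧≤1 : ∀ b → ⟦ b ⟧ ≤ 1
⟦⟧≤1 true  = ≤-refl
⟦⟧≤1 false = z≤n

⟦⟧*-positive : ∀ b {x} → 0 < ⟦ b ⟧ * x → b ≡ true × 0 < x
⟦⟧*-positive true {x} 0<x = refl , ≤-trans 0<x (≤-reflexive (*-identityˡ x))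

⟦⟧*⟦⟧-positive : ∀ b c → 0 < ⟦ b ⟧ * ⟦ c ⟧ → b ≡ true × c ≡ true
⟦⟧*⟦⟧-positive true true _ = refl , refl

sum-+ : (f g : Vector ℕ n) → sumℕ (λ i → f i + g i) ≡ sumℕ f + sumℕ g
sum-+ f g = ∑-distrib-+ f g

sum-*ˡ : ∀ c (f : Vector ℕ n) → sumℕ (λ i → c * f i) ≡ c * sumℕ f
sum-*ˡ c f = sym (*-distribˡ-sum c f)

sum-*ʳ : ∀ c (f : Vector ℕ n) → sumℕ (λ i → f i * c) ≡ sumℕ f * c
sum-*ʳ c f = sym (*-distribʳ-sum c f)

sum²-swap : (f : Fin n → Fin n → ℕ) →
  sumℕ (λ i → sumℕ (f i)) ≡ sumℕ (λ j → sumℕ λ i → f i j)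
sum²-swap f = ∑-comm f

sum-mono : {f g : Vector ℕ n} → (∀ i → f i ≤ g i) → sumℕ f ≤ sumℕ g
sum-mono {zero}  f≤g = z≤n
sum-mono {suc n} f≤g = +-mono-≤ (f≤g zero) (sum-mono (f≤g ∘ suc))

sum-const : ∀ n c → sumℕ {n} (λ _ → c) ≡ n * c
sum-const zero    c = refl
sum-const (suc n) c = cong (_+_ c) (sum-const n c)

sum-zero : {f : Vector ℕ n} → (∀ i → f i ≡ 0) → sumℕ f ≡ 0
sum-zero {n} f≡0 = trans (sum-cong-≗ f≡0) (sum-replicate-zero n)

≤-sum : (f : Vector ℕ n) → ∀ i → f i ≤ sumℕ f
≤-sum f zero    = m≤m+n _ _
≤-sum f (suc i) = ≤-trans (≤-sum (f ∘ suc) i) (m≤n+m _ (f zero))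

-- With rows of a graph as `f` and `g`, this turns an inclusion of neighbourhoods into an equality
-- once the degrees are compared.
sum-mono-≡ : {f g : Vector ℕ n} → (∀ i → f i ≤ g i) → sumℕ g ≤ sumℕ f → ∀ i → f i ≡ g i
sum-mono-≡ {f = f} {g} f≤g Σg≤Σf zero    = ≤-antisym (f≤g zero)
  (+-cancelʳ-≤ _ _ _ (≤-trans Σg≤Σf (+-monoʳ-≤ (f zero) (sum-mono (f≤g ∘ suc)))))
sum-mono-≡ {f = f} {g} f≤g Σg≤Σf (suc i) = sum-mono-≡ (f≤g ∘ suc)
  (+-cancelˡ-≤ (g zero) _ _ (≤-trans Σg≤Σf (+-monoˡ-≤ _ (f≤g zero)))) i

-- The "at most one" facts enter the counts through this bound: the edge between `B` and `R`, the
-- blossom in `A`, the non-neighbour in `A` of a vertex of `V`.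
sum-unit : {f : Vector ℕ n} → (∀ i → f i ≤ 1) → (∀ i j → 0 < f i → 0 < f j → i ≡ j) → sumℕ f ≤ 1
sum-unit {zero}          f≤1 uniq = z≤n
sum-unit {suc n} {f = f} f≤1 uniq with f zero in eq
... | zero  = sum-unit (f≤1 ∘ suc)
  λ i j p q → Fin.suc-injective (uniq (suc i) (suc j) p q)
... | suc k = subst (_≤ 1) (sym (trans (cong (_+_ (suc k)) (sum-zero rest)) (+-identityʳ _)))
                (subst (_≤ 1) eq (f≤1 zero))
  where
  rest : ∀ i → f (suc i) ≡ 0
  rest i with f (suc i) in eq′
  ... | zero   = refl
  ... | suc k′ with () ← uniq zero (suc i) (subst (0 <_) (sym eq) z<s) (subst (0 <_) (sym eq′) z<s)

sum-positive : (f : Vector ℕ n) → 0 < sumℕ f → ∃ λ i → 0 < f i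
sum-positive {suc n} f 0<Σ with f zero in eq
... | suc k = zero , ≤-trans z<s (≤-reflexive (sym eq))
... | zero with sum-positive (f ∘ suc) 0<Σ
...   | i , 0<fi = suc i , 0<fi

sum-e : (u : Fin n) → sumℕ (e u) ≡ 1
sum-e {suc n} zero    = cong suc (sum-zero {n} {λ i → e zero (suc i)} λ _ → refl)
sum-e (suc u) = trans (sum-cong-≗ shift) (sum-e u)
  where
  shift : ∀ i → e (suc u) (suc i) ≡ e u i
  shift i with u ≟ i
  ... | yes _ = refl
  ... | no _  = refl

e-diag : (u : Fin n) → e u u ≡ 1
e-diag u with u ≟ u
... | yes _  = refl
... | no u≢u = contradiction refl u≢u

e-off : {u v : Fin n} → u ≢ v → e u v ≡ 0
e-off {u = u} {v} u≢v with u ≟ v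
... | yes u≡v = contradiction u≡v u≢v
... | no _    = refl

-- Graphs as Boolean matrices

Adj : ℕ → Set
Adj n = Fin n → Fin n → Bool

record Simple (g : Adj n) : Set where
  field
    symm : ∀ i j → g i j ≡ g j i
    irr  : ∀ i → g i i ≡ false

deg : Adj n → Fin n → ℕ
deg g i = sumℕ λ j → ⟦ g i j ⟧

-- The necessity half of the Erdős–Gallai criterion, for disjoint X and Y; both
-- sides are moved so that no subtraction occurs.
module _ {g : Adj n} (g-simple : Simple g) (X Y : Fin n → Bool) (disjoint : ∀ i → X i ≡ true → Y i ≡ false) where

  open Simple g-simple
  open ≤-Reasoning

  private
    x y : Vector ℕ n
    x i = ⟦ X i ⟧
    y i = ⟦ Y i ⟧

    -- Outside `Y` an entry is at most 1. On the diagonal `e i i` takes the place of the missing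
    -- loop, and `y i` vanishes by disjointness.
    step : ∀ i → X i ≡ true → ∀ j → ⟦ g i j ⟧ + e i j + y j ≤ 1 + y j * ⟦ g i j ⟧
    step i Xi j with i ≟ j
    ... | yes refl rewrite irr i | disjoint i Xi = ≤-refl
    ... | no _ with g i j | Y j
    ...   | true  | true  = ≤-refl
    ...   | true  | false = ≤-refl
    ...   | false | true  = ≤-refl
    ...   | false | false = z≤n

    row : ∀ i → X i ≡ true → deg g i + 1 + sumℕ y ≤ n + sumℕ (λ j → y j * ⟦ g i j ⟧)
    row i Xi = begin
      deg g i + 1 + sumℕ y                               ≡⟨ cong (λ z → deg g i + z + sumℕ y) (sum-e i) ⟨
      deg g i + sumℕ (e i) + sumℕ y                      ≡⟨ cong (_+ sumℕ y) (sum-+ (λ j → ⟦ g i j ⟧) (e i)) ⟨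
      sumℕ (λ j → ⟦ g i j ⟧ + e i j) + sumℕ y            ≡⟨ sum-+ (λ j → ⟦ g i j ⟧ + e i j) y ⟨
      sumℕ (λ j → ⟦ g i j ⟧ + e i j + y j)               ≤⟨ sum-mono (step i Xi) ⟩
      sumℕ (λ j → 1 + y j * ⟦ g i j ⟧)                   ≡⟨ sum-+ (λ _ → 1) (λ j → y j * ⟦ g i j ⟧) ⟩
      sumℕ {n} (λ _ → 1) + s                             ≡⟨ cong (_+ s) (trans (sum-const n 1) (*-identityʳ n)) ⟩
      n + s                                              ∎
      where s = sumℕ (λ j → y j * ⟦ g i j ⟧)

    weighted : ∀ i → x i * deg g i + x i * (1 + sumℕ y) ≤ x i * n + x i * sumℕ (λ j → y j * ⟦ g i j ⟧)
    weighted i with X i in Xi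
    ... | false = z≤n
    ... | true  rewrite *-identityˡ (deg g i) | *-identityˡ (sumℕ y) | *-identityˡ n
                      | *-identityˡ (sumℕ λ j → y j * ⟦ g i j ⟧) =
      ≤-trans (≤-reflexive (sym (+-assoc (deg g i) 1 (sumℕ y)))) (row i Xi)

    cross : sumℕ (λ i → x i * sumℕ (λ j → y j * ⟦ g i j ⟧)) ≤ sumℕ (λ j → y j * deg g j)
    cross = begin
      sumℕ (λ i → x i * sumℕ (λ j → y j * ⟦ g i j ⟧))    ≡⟨ sum-cong-≗ (λ i → sum-*ˡ (x i) (λ j → y j * ⟦ g i j ⟧)) ⟨
      sumℕ (λ i → sumℕ λ j → x i * (y j * ⟦ g i j ⟧))    ≡⟨ sum²-swap (λ i j → x i * (y j * ⟦ g i j ⟧)) ⟩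
      sumℕ (λ j → sumℕ λ i → x i * (y j * ⟦ g i j ⟧))    ≤⟨ sum-mono (λ j → sum-mono (λ i → bound i j)) ⟩
      sumℕ (λ j → sumℕ λ i → y j * ⟦ g j i ⟧)            ≡⟨ sum-cong-≗ (λ j → sum-*ˡ (y j) (λ i → ⟦ g j i ⟧)) ⟩
      sumℕ (λ j → y j * deg g j)                         ∎
      where
      bound : ∀ i j → x i * (y j * ⟦ g i j ⟧) ≤ y j * ⟦ g j i ⟧
      bound i j rewrite symm i j =
        ≤-trans (*-monoˡ-≤ _ (⟦⟧≤1 (X i))) (≤-reflexive (*-identityˡ _))

  erdős–gallai : sumℕ (λ i → x i * deg g i) + sumℕ x * (1 + sumℕ y) ≤ sumℕ (λ i → y i * deg g i) + sumℕ x * n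
  erdős–gallai = begin
    xd + sumℕ x * (1 + sumℕ y)                                ≡⟨ cong (_+_ xd) (sum-*ʳ (1 + sumℕ y) x) ⟨
    xd + sumℕ (λ i → x i * (1 + sumℕ y))                      ≡⟨ sum-+ (λ i → x i * deg g i) (λ i → x i * (1 + sumℕ y)) ⟨
    sumℕ (λ i → x i * deg g i + x i * (1 + sumℕ y))           ≤⟨ sum-mono weighted ⟩
    sumℕ (λ i → x i * n + x i * yg i)                         ≡⟨ sum-+ (λ i → x i * n) (λ i → x i * yg i) ⟩
    sumℕ (λ i → x i * n) + sumℕ (λ i → x i * yg i)            ≡⟨ cong (_+ sumℕ (λ i → x i * yg i)) (sum-*ʳ n x) ⟩
    sumℕ x * n + sumℕ (λ i → x i * yg i)                      ≤⟨ +-monoʳ-≤ (sumℕ x * n) cross ⟩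
    sumℕ x * n + sumℕ (λ i → y i * deg g i)                   ≡⟨ +-comm (sumℕ x * n) _ ⟩
    sumℕ (λ i → y i * deg g i) + sumℕ x * n                   ∎
    where
    xd = sumℕ (λ i → x i * deg g i)
    yg = λ i → sumℕ (λ j → y j * ⟦ g i j ⟧)

adj : Neighbourhoods n → Adj n
adj G i j = lookup (lookup G i) j

∣∣≡sum : (s : Subset n) → ∣ s ∣ ≡ sumℕ λ j → ⟦ lookup s j ⟧
∣∣≡sum []            = refl
∣∣≡sum (inside  ∷ s) = cong suc (∣∣≡sum s)
∣∣≡sum (outside ∷ s) = ∣∣≡sum s

adj-simple : {G : Neighbourhoods n} → IsSimpleGraph G → Simple (adj G)
adj-simple {G = G} (mkSimple s r) = record { symm = symm ; irr = irr }
  where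
  symm : ∀ i j → adj G i j ≡ adj G j i
  symm i j with adj G i j in ij | adj G j i in ji
  ... | true  | true  = refl
  ... | false | false = refl
  ... | true  | false = trans (sym ([]=⇒lookup (s i j (lookup⇒[]= j _ ij)))) ji
  ... | false | true  = trans (sym ij) ([]=⇒lookup (s j i (lookup⇒[]= i _ ji)))

  irr : ∀ i → adj G i i ≡ false
  irr i with adj G i i in ii
  ... | false = refl
  ... | true  = contradiction (lookup⇒[]= i _ ii) (r i)

-- Arithmetic of the three contradictions

absurd : ∀ {a b} → a ≤ b → ∀ r → a ≡ suc (b + r) → ⊥
absurd {a} {b} a≤b r refl = <-irrefl refl (≤-trans (s≤s (m≤m+n b r)) a≤b)

private
  -- Farkas-style certificates: on the left stands a weighted sum of the left sides of the
  -- inequalities, and on the right the same combination of their right sides, exceeded by 1 or 2.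
  -- Such an identity is what `absurd` consumes, with the excess beyond 1 as `r`.
  all-low-below-arith : ∀ α β ρ X θ c₂ P →
    α * α + 2 * (α * ρ) + 2 * (X + θ) + 2 * (c₂ * β + 2) + (P + α * (1 + (ρ + β))) + 2 * ρ * c₂
    ≡ suc (P + (ρ + β) * c₂ + 2 + α + 2 * (X + θ) + ((ρ + β) * c₂ + α * (α + (ρ + β))) + 2 * ρ * α + 1)
  all-low-below-arith = solve-∀

  high-above-low-below-arith : ∀ α β ρ X θ c₁ c₂ →
    α * c₁ + α * (1 + β) + (α * (α + ρ) + X) + (c₂ * β + 2) + θ
    ≡ suc (β * c₂ + α * (α + (ρ + β)) + (c₁ * α + α) + (X + θ) + 1 + 0)
  high-above-low-below-arith = solve-∀

  all-high-above-arith : ∀ α β ρ X θ ε c₁ Q →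
    (α + ρ) * c₁ + (α + ρ) * (1 + β) + 2 * (α * (α + ρ) + X) + ((α + ρ) * c₁ + Q + 2 + (α + ρ)) + 2 * (α * ρ + ρ * ρ + ε) + 2 * θ
    ≡ suc (Q + (α + ρ) * (α + (ρ + β)) + 2 * (c₁ * α + α) + (α * α + 2 * (α * ρ) + 2 * (X + θ + ε) + ρ * ρ) + 2 * (c₁ * ρ) + 2 * ρ + 1)
  all-high-above-arith = solve-∀

-- Arithmetic shared by the three ways in which the values of an extremal
-- sequence can be placed relative to a partition U ⊎ R ⊎ W with |U| = α,
-- |R| = ρ, |W| = β: X counts the edges between U and W, θ those between B and
-- R, and ε those between W ∖ B and R, for some B ⊆ W.
module _ {α β ρ X θ c₁ c₂ : ℕ} where

  all-low-below : ∀ {P} → P + α * (1 + (ρ + β)) ≤ (ρ + β) * c₂ + α * (α + (ρ + β)) →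
    c₂ * β + 2 ≤ X + θ →
    α * α + 2 * (α * ρ) + 2 * (X + θ) ≤ P + (ρ + β) * c₂ + 2 + α →
    θ ≤ 1 → X ≤ α * β → ⊥
  all-low-below {P} cut h₂ h₃ θ≤1 X≤αβ =
    absurd (+-mono-≤ (+-mono-≤ (+-mono-≤ h₃ (*-monoʳ-≤ 2 h₂)) cut) (*-monoʳ-≤ (2 * ρ) (<⇒≤ c₂<α))) 1
      (all-low-below-arith α β ρ X θ c₂ P)
    where
    -- The two surplus units in `h₂` outweigh the at most one edge counted by `θ`; this strictness
    -- is what yields `c₂ < α`.
    c₂β<X : c₂ * β < X
    c₂β<X = +-cancelʳ-< 1 (c₂ * β) X
      (≤-trans (≤-reflexive (sym (+-suc (c₂ * β) 1))) (≤-trans h₂ (+-monoʳ-≤ X θ≤1)))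

    c₂<α : c₂ < α
    c₂<α = *-cancelʳ-< β c₂ α (≤-trans c₂β<X X≤αβ)

  high-above-low-below : α * c₁ + α * (1 + β) ≤ β * c₂ + α * (α + (ρ + β)) →
    α * (α + ρ) + X ≤ c₁ * α + α →
    c₂ * β + 2 ≤ X + θ → θ ≤ 1 → ⊥
  high-above-low-below cut h₁ h₂ θ≤1 =
    absurd (+-mono-≤ (+-mono-≤ (+-mono-≤ cut h₁) h₂) θ≤1) 0 (high-above-low-below-arith α β ρ X θ c₁ c₂)

  all-high-above : ∀ {ε Q} → (α + ρ) * c₁ + (α + ρ) * (1 + β) ≤ Q + (α + ρ) * (α + (ρ + β)) →
    α * (α + ρ) + X ≤ c₁ * α + α →
    (α + ρ) * c₁ + Q + 2 + (α + ρ) ≤ α * α + 2 * (α * ρ) + 2 * (X + θ + ε) + ρ * ρ →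
    α * ρ + ρ * ρ + ε ≤ c₁ * ρ → θ ≤ ρ → ⊥
  all-high-above {ε} {Q} cut h₁ h₄ h₅ θ≤ρ =
    absurd (+-mono-≤ (+-mono-≤ (+-mono-≤ (+-mono-≤ cut (*-monoʳ-≤ 2 h₁)) h₄) (*-monoʳ-≤ 2 h₅)) (*-monoʳ-≤ 2 θ≤ρ)) 1
      (all-high-above-arith α β ρ X θ ε c₁ Q)

-- Extremal sequences

lt ge : ℕ → Fin n → Bool
lt k i = toℕ i <ᵇ k
ge k i = not (lt k i)

sum-lt : ∀ k m → k + m ≡ n → sumℕ {n} (⟦_⟧ ∘ lt k) ≡ k
sum-lt zero    m refl = sum-zero {m} λ i → refl
sum-lt (suc k) m refl = cong suc (sum-lt k m refl)

sum-ge : ∀ k m → k + m ≡ n → sumℕ {n} (⟦_⟧ ∘ ge k) ≡ m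
sum-ge zero    m refl = trans (sum-const m 1) (*-identityʳ m)
sum-ge (suc k) m refl = sum-ge k m refl

lt-ge : ∀ k (f : Vector ℕ n) → sumℕ (λ i → ⟦ lt k i ⟧ * f i) + sumℕ (λ i → ⟦ ge k i ⟧ * f i) ≡ sumℕ f
lt-ge k f = trans (sym (sum-+ (λ i → ⟦ lt k i ⟧ * f i) (λ i → ⟦ ge k i ⟧ * f i))) (sum-cong-≗ split)
  where
  split : ∀ i → ⟦ lt k i ⟧ * f i + ⟦ ge k i ⟧ * f i ≡ f i
  split i with lt k i
  ... | true  = trans (+-identityʳ _) (*-identityˡ (f i))
  ... | false = *-identityˡ (f i)

-- An amount `S` is poured from the left into boxes of capacity `w`. With `w = c₁ ∸ c₂`, adding `c₂`
-- everywhere gives the extremal sequence (c₁, ..., c₁, x, c₂, ..., c₂).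
fill : ℕ → ℕ → Fin n → ℕ
fill w S zero    = w ⊓ S
fill w S (suc i) = fill w (S ∸ w) i

module _ (w : ℕ) where

  private
    dec : ∀ {S} k → S ≤ suc k * w → S ∸ w ≤ k * w
    dec {S} k S≤ = subst (S ∸ w ≤_) (m+n∸m≡n w (k * w)) (∸-monoˡ-≤ w S≤)

  fill≤w : ∀ S (i : Fin n) → fill w S i ≤ w
  fill≤w S zero    = m⊓n≤m w S
  fill≤w S (suc i) = fill≤w (S ∸ w) i

  fill-empty : (i : Fin n) → fill w 0 i ≡ 0
  fill-empty zero    = ⊓-zeroʳ w
  fill-empty (suc i) = trans (cong (λ S → fill w S i) (0∸n≡0 w)) (fill-empty i)

  fill-first : ∀ k m S → k + m ≡ n → k * w ≤ S → sumℕ {n} (λ i → ⟦ lt k i ⟧ * fill w S i) ≡ k * w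
  fill-first zero    m S refl kw≤S = sum-zero {m} λ i → refl
  fill-first (suc k) m S refl kw≤S = cong₂ _+_
    (trans (*-identityˡ _) (m≤n⇒m⊓n≡m (≤-trans (m≤m+n w (k * w)) kw≤S)))
    (fill-first k m (S ∸ w) refl (subst (_≤ S ∸ w) (m+n∸m≡n w (k * w)) (∸-monoˡ-≤ w kw≤S)))

  fill-rest : ∀ k m S → k + m ≡ n → S ≤ k * w → sumℕ {n} (λ i → ⟦ ge k i ⟧ * fill w S i) ≡ 0
  fill-rest zero    m .0 refl z≤n  = sum-zero {m} λ i → trans (*-identityˡ _) (fill-empty i)
  fill-rest (suc k) m S  refl S≤kw = fill-rest k m (S ∸ w) refl (dec k S≤kw)

  sum-fill : ∀ S → S ≤ n * w → sumℕ {n} (fill w S) ≡ S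
  sum-fill {zero}  .0 z≤n = refl
  sum-fill {suc n} S S≤nw = trans (cong (_+_ (w ⊓ S)) (sum-fill {n} (S ∸ w) (dec n S≤nw))) (m⊓n+n∸m≡n w S)

module _ {c₁ c₂ Σ : ℕ} (0<c₂ : 0 < c₂) (c₂≤c₁ : c₂ ≤ c₁) (c₁<n : c₁ < n)
  (2∣Σ : 2 ∣ Σ) (Σ≤nc₁ : Σ ≤ n * c₁) (nc₂≤Σ : n * c₂ ≤ Σ) where

  private
    w S : ℕ
    w = c₁ ∸ c₂
    S = Σ ∸ n * c₂

    c₂+w : c₂ + w ≡ c₁
    c₂+w = m+[n∸m]≡n c₂≤c₁

    kc₁ : ∀ k → k * c₂ + k * w ≡ k * c₁
    kc₁ k = trans (sym (*-distribˡ-+ k c₂ w)) (cong (k *_) c₂+w)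

    S≤nw : S ≤ n * w
    S≤nw = subst (S ≤_) (m+n∸m≡n (n * c₂) (n * w))
      (∸-monoˡ-≤ (n * c₂) (≤-trans Σ≤nc₁ (≤-reflexive (sym (kc₁ n)))))

  greedy : Vector ℕ n
  greedy i = c₂ + fill w S i

  private
    weighted : (x : Vector ℕ n) → sumℕ (λ i → x i * greedy i) ≡ sumℕ x * c₂ + sumℕ (λ i → x i * fill w S i)
    weighted x = trans (sum-cong-≗ λ i → *-distribˡ-+ (x i) c₂ (fill w S i))
      (trans (sum-+ (λ i → x i * c₂) (λ i → x i * fill w S i)) (cong (_+ sumℕ (λ i → x i * fill w S i)) (sum-*ʳ c₂ x)))

  sum-greedy : sumℕ greedy ≡ Σ
  sum-greedy = trans (sum-+ {n} (λ _ → c₂) (fill w S))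
    (trans (cong₂ _+_ (sum-const n c₂) (sum-fill w {n} S S≤nw)) (m+[n∸m]≡n nc₂≤Σ))

  greedy≤c₁ : ∀ i → greedy i ≤ c₁
  greedy≤c₁ i = ≤-trans (+-monoʳ-≤ c₂ (fill≤w w S i)) (≤-reflexive c₂+w)

  greedy∈𝔻 : 𝔻 n Σ c₁ c₂ greedy
  greedy∈𝔻 = record
    { isDegreeSequence = record
      { positive = λ i → ≤-trans 0<c₂ (m≤m+n c₂ _)
      ; bounded  = λ i → ≤-trans (greedy≤c₁ i) (∸-monoˡ-≤ 1 c₁<n)
      ; even     = subst (2 ∣_) (sym sum-greedy) 2∣Σ
      }
    ; upper = greedy≤c₁
    ; lower = λ i → m≤m+n c₂ _
    ; total = sum-greedy
    }

  -- The sequence drops from `c₁` to `c₂` within a single position, which lies on one side of the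
  -- cut at `k`; comparing `k * w` with `S` tells which.
  greedy-split : ∀ k m → k + m ≡ n →
    sumℕ (λ i → ⟦ lt k i ⟧ * greedy i) ≡ k * c₁ ⊎ sumℕ (λ i → ⟦ ge k i ⟧ * greedy i) ≡ m * c₂
  greedy-split k m k+m≡n = Sum.map first rest (≤-total (k * w) S)
    where
    first : k * w ≤ S → sumℕ (λ i → ⟦ lt k i ⟧ * greedy i) ≡ k * c₁
    first kw≤S = trans (weighted (⟦_⟧ ∘ lt k)) (trans
      (cong₂ _+_ (cong (_* c₂) (sum-lt k m k+m≡n)) (fill-first w k m S k+m≡n kw≤S)) (kc₁ k))

    rest : S ≤ k * w → sumℕ (λ i → ⟦ ge k i ⟧ * greedy i) ≡ m * c₂
    rest S≤kw = trans (weighted (⟦_⟧ ∘ ge k)) (trans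
      (cong₂ _+_ (cong (_* c₂) (sum-ge k m k+m≡n)) (fill-rest w k m S k+m≡n S≤kw)) (+-identityʳ _))

  module _ (fg : FullyGraphic (𝔻 n Σ c₁ c₂)) where

    private
      first rest : ℕ → ℕ
      first k = sumℕ λ i → ⟦ lt k i ⟧ * greedy i
      rest  k = sumℕ λ i → ⟦ ge k i ⟧ * greedy i

      -- Full graphicness provides a realization of `greedy`, to which Erdős-Gallai applies with the
      -- first `α` positions against the last `β`; the middle `ρ` stay outside both sets.
      cut : ∀ α ρ β → α + (ρ + β) ≡ n → first α + α * (1 + β) ≤ rest (α + ρ) + α * n
      cut α ρ β α+ρ+β≡n with fg greedy greedy∈𝔻
      ... | G , mkRealization simple degrees = subst₂ _≤_
        (cong₂ _+_ (sum-cong-≗ λ i → cong (⟦ lt α i ⟧ *_) (deg≡ i))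
          (cong₂ (λ x y → x * (1 + y)) (sum-lt α (ρ + β) α+ρ+β≡n) (sum-ge (α + ρ) β (trans (+-assoc α ρ β) α+ρ+β≡n))))
        (cong₂ _+_ (sum-cong-≗ λ i → cong (⟦ ge (α + ρ) i ⟧ *_) (deg≡ i))
          (cong (_* n) (sum-lt α (ρ + β) α+ρ+β≡n)))
        (erdős–gallai (adj-simple simple) (lt α) (ge (α + ρ)) (λ i → disjoint (toℕ i) α))
        where
        deg≡ : ∀ i → deg (adj G) i ≡ greedy i
        deg≡ i = trans (sym (∣∣≡sum (lookup G i))) (degrees i)

        disjoint : ∀ i α → (i <ᵇ α) ≡ true → not (i <ᵇ (α + ρ)) ≡ false
        disjoint zero    (suc α) i<α = refl
        disjoint (suc i) (suc α) i<α = disjoint i α i<α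

      cut′ : ∀ α β → α + β ≡ n → first α + α * (1 + β) ≤ rest α + α * n
      cut′ α β α+β≡n = subst (λ k → first α + α * (1 + β) ≤ rest k + α * n) (+-identityʳ α) (cut α 0 β α+β≡n)

      total : ∀ k → first k + rest k ≡ Σ
      total k = trans (lt-ge k greedy) sum-greedy

    -- `h₁` comes from the upper bound `c₁` on U, `h₂` from the lower bound `c₂` on W with the two
    -- surplus units, `h₅` from `c₁` as felt in R. `h₃` and `h₄` are the degree sum with R taken as
    -- sparse and as dense as possible. The drop of `greedy` lies in the block of U (`case₁`), of R
    -- (`case₃`) or of W (`case₂`).
    no-tight-partition : ∀ α β ρ X θ ε → α + (ρ + β) ≡ n →
      α * (α + ρ) + X ≤ c₁ * α + α →
      c₂ * β + 2 ≤ X + θ →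
      α * α + 2 * (α * ρ) + 2 * (X + θ) ≤ Σ + 2 + α →
      Σ + 2 + (α + ρ) ≤ α * α + 2 * (α * ρ) + 2 * (X + θ + ε) + ρ * ρ →
      α * ρ + ρ * ρ + ε ≤ c₁ * ρ →
      θ ≤ 1 → θ ≤ ρ → X ≤ α * β → ⊥
    no-tight-partition α β ρ X θ ε α+ρ+β≡n h₁ h₂ h₃ h₄ h₅ θ≤1 θ≤ρ X≤αβ =
      Sum.[ (λ Pα → Sum.[ case₂ , case₃ Pα ] (greedy-split (α + ρ) β αρ+β≡n)) , case₁ ] (greedy-split α (ρ + β) α+ρ+β≡n)
      where
      αρ+β≡n : α + ρ + β ≡ n
      αρ+β≡n = trans (+-assoc α ρ β) α+ρ+β≡n

      case₁ : rest α ≡ (ρ + β) * c₂ → ⊥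
      case₁ Qα = all-low-below {α} {β} {ρ} {X} {θ} {c₁} {c₂} {first α}
        (subst₂ (λ Q N → first α + α * (1 + (ρ + β)) ≤ Q + α * N) Qα (sym α+ρ+β≡n) (cut′ α (ρ + β) α+ρ+β≡n))
        h₂ (subst (λ S → α * α + 2 * (α * ρ) + 2 * (X + θ) ≤ S + 2 + α)
          (trans (sym (total α)) (cong (_+_ (first α)) Qα)) h₃) θ≤1 X≤αβ

      case₂ : first (α + ρ) ≡ (α + ρ) * c₁ → ⊥
      case₂ Pαρ = all-high-above {α} {β} {ρ} {X} {θ} {c₁} {c₂} {ε} {rest (α + ρ)}
        (subst₂ (λ P N → P + (α + ρ) * (1 + β) ≤ rest (α + ρ) + (α + ρ) * N) Pαρ (sym α+ρ+β≡n)
          (cut′ (α + ρ) β αρ+β≡n))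
        h₁ (subst (λ S → S + 2 + (α + ρ) ≤ α * α + 2 * (α * ρ) + 2 * (X + θ + ε) + ρ * ρ)
          (trans (sym (total (α + ρ))) (cong (_+ rest (α + ρ)) Pαρ)) h₄)
        h₅ θ≤ρ

      case₃ : first α ≡ α * c₁ → rest (α + ρ) ≡ β * c₂ → ⊥
      case₃ Pα Qαρ = high-above-low-below {α} {β} {ρ} {X} {θ} {c₁} {c₂}
        (subst (λ N → α * c₁ + α * (1 + β) ≤ β * c₂ + α * N) (sym α+ρ+β≡n)
          (subst₂ (λ P Q → P + α * (1 + β) ≤ Q + α * n) Pα Qαρ (cut α ρ β α+ρ+β≡n)))
        h₁ h₂ θ≤1

-- Counting edges between the parts of an obstruction

card : (Fin n → Bool) → ℕ
card P = sumℕ (⟦_⟧ ∘ P)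

over : (Fin n → Bool) → Vector ℕ n → ℕ
over P f = sumℕ λ i → ⟦ P i ⟧ * f i

over-mono : (P : Fin n → Bool) {f g : Vector ℕ n} → (∀ i → P i ≡ true → f i ≤ g i) → over P f ≤ over P g
over-mono P f≤g = sum-mono λ i → weighted i (P i) refl
  where
  weighted : ∀ i b → P i ≡ b → ⟦ b ⟧ * _ ≤ ⟦ b ⟧ * _
  weighted i true  Pi = *-monoʳ-≤ 1 (f≤g i Pi)
  weighted i false Pi = z≤n

over-cong : (P : Fin n → Bool) {f g : Vector ℕ n} → (∀ i → P i ≡ true → f i ≡ g i) → over P f ≡ over P g
over-cong P f≡g = ≤-antisym (over-mono P λ i Pi → ≤-reflexive (f≡g i Pi))
                            (over-mono P λ i Pi → ≤-reflexive (sym (f≡g i Pi)))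

over-+ : (P : Fin n → Bool) (f g : Vector ℕ n) → over P (λ i → f i + g i) ≡ over P f + over P g
over-+ P f g = trans (sum-cong-≗ λ i → *-distribˡ-+ ⟦ P i ⟧ (f i) (g i))
                     (sum-+ (λ i → ⟦ P i ⟧ * f i) (λ i → ⟦ P i ⟧ * g i))

over-const : (P : Fin n → Bool) (c : ℕ) → over P (λ _ → c) ≡ card P * c
over-const P c = sum-*ʳ c (⟦_⟧ ∘ P)

over-one : (P : Fin n → Bool) → over P (λ _ → 1) ≡ card P
over-one P = trans (over-const P 1) (*-identityʳ (card P))

over-point : (P : Fin n → Bool) (u : Fin n) → P u ≡ true → over P (e u) ≡ 1
over-point P u Pu = trans (sum-cong-≗ point) (sum-e u)
  where
  point : ∀ i → ⟦ P i ⟧ * e u i ≡ e u i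
  point i with u ≟ i
  ... | yes refl rewrite Pu = refl
  ... | no _ = *-zeroʳ ⟦ P i ⟧

edges : Adj n → (P Q : Fin n → Bool) → ℕ
edges h P Q = over P λ i → over Q λ j → ⟦ h i j ⟧

edges-comm : {h : Adj n} → Simple h → ∀ P Q → edges h P Q ≡ edges h Q P
edges-comm {h = h} simple P Q =
  trans (sum-cong-≗ λ i → sym (sum-*ˡ ⟦ P i ⟧ (λ j → ⟦ Q j ⟧ * ⟦ h i j ⟧)))
  (trans (sum²-swap λ i j → ⟦ P i ⟧ * (⟦ Q j ⟧ * ⟦ h i j ⟧))
  (sum-cong-≗ λ j → trans (sum-cong-≗ λ i → exchange i j)
                          (sum-*ˡ ⟦ Q j ⟧ (λ i → ⟦ P i ⟧ * ⟦ h j i ⟧))))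
  where
  exchange : ∀ i j → ⟦ P i ⟧ * (⟦ Q j ⟧ * ⟦ h i j ⟧) ≡ ⟦ Q j ⟧ * (⟦ P i ⟧ * ⟦ h j i ⟧)
  exchange i j rewrite Simple.symm simple i j =
    trans (sym (*-assoc ⟦ P i ⟧ _ _)) (trans (cong (_* ⟦ h j i ⟧) (*-comm ⟦ P i ⟧ ⟦ Q j ⟧)) (*-assoc ⟦ Q j ⟧ _ _))

-- The independent set W is B ⊎ V.
data Part : Set where
  U B V R : Part

isU isB isV isR isW : Part → Bool
isU U = true
isU _ = false
isB B = true
isB _ = false
isV V = true
isV _ = false
isR R = true
isR _ = false
isW B = true
isW V = true
isW _ = false

-- The conclusion of the structural analysis of a realization h of D + e_p + e_q
-- without a short alternating trail from p to q. At most one edge joins B and R.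
record Obstruction (h : Adj n) (D : Vector ℕ n) (c₁ c₂ : ℕ) (p q : Fin n) (part : Fin n → Part) : Set where
  field
    simple   : Simple h
    degrees  : ∀ i → deg h i ≡ D i + e p i + e q i
    upper    : ∀ i → D i ≤ c₁
    lower    : ∀ i → c₂ ≤ D i
    p∈B      : part p ≡ B
    q∈B      : part q ≡ B
    UU       : ∀ i j → part i ≡ U → part j ≡ U → i ≢ j → h i j ≡ true
    UR       : ∀ i j → part i ≡ U → part j ≡ R → h i j ≡ true
    WW       : ∀ i j → isW (part i) ≡ true → isW (part j) ≡ true → h i j ≡ false
    BR       : ∀ b r b′ r′ → part b ≡ B → part r ≡ R → h r b ≡ true →
               part b′ ≡ B → part r′ ≡ R → h r′ b′ ≡ true → b ≡ b′ × r ≡ r′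
    VU       : ∀ i → part i ≡ V → c₂ ≤ over (isU ∘ part) (λ j → ⟦ h i j ⟧)
    R-domin  : ∀ i → part i ≡ R → ∃ λ u → part u ≡ U × h u p ≡ true ×
               (∀ j → part j ≡ V → h i j ≡ true → h u j ≡ true)

module _ {h : Adj n} {D : Vector ℕ n} {c₁ c₂ : ℕ} {p q : Fin n} {part : Fin n → Part}
  (obstruction : Obstruction h D c₁ c₂ p q part) where

  open Obstruction obstruction
  open Simple simple

  private
    𝐔 𝐁 𝐕 𝐑 𝐖 : Fin n → Bool
    𝐔 = isU ∘ part
    𝐁 = isB ∘ part
    𝐕 = isV ∘ part
    𝐑 = isR ∘ part
    𝐖 = isW ∘ part

    α β ρ X θ ε : ℕ
    α = card 𝐔
    β = card 𝐖
    ρ = card 𝐑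
    X = edges h 𝐔 𝐖
    θ = edges h 𝐑 𝐁
    ε = edges h 𝐑 𝐕

    toU : ∀ {i} → 𝐔 i ≡ true → part i ≡ U
    toU {i} eq with part i
    ... | U = refl

    toB : ∀ {i} → 𝐁 i ≡ true → part i ≡ B
    toB {i} eq with part i
    ... | B = refl

    toV : ∀ {i} → 𝐕 i ≡ true → part i ≡ V
    toV {i} eq with part i
    ... | V = refl

    toR : ∀ {i} → 𝐑 i ≡ true → part i ≡ R
    toR {i} eq with part i
    ... | R = refl

    B⊆W : ∀ {i} → 𝐁 i ≡ true → 𝐖 i ≡ true
    B⊆W {i} eq with part i
    ... | B = refl

    W-split : (f : Vector ℕ n) → over 𝐖 f ≡ over 𝐁 f + over 𝐕 f
    W-split f = trans (sum-cong-≗ λ i → split (f i) (part i)) (sum-+ (λ i → ⟦ 𝐁 i ⟧ * f i) (λ i → ⟦ 𝐕 i ⟧ * f i))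
      where
      split : ∀ x P → ⟦ isW P ⟧ * x ≡ ⟦ isB P ⟧ * x + ⟦ isV P ⟧ * x
      split x U = refl
      split x B = sym (+-identityʳ _)
      split x V = refl
      split x R = refl

    total-split : (f : Vector ℕ n) → sumℕ f ≡ over 𝐔 f + (over 𝐑 f + over 𝐖 f)
    total-split f = trans (sum-cong-≗ λ i → split (f i) (part i))
      (trans (sum-+ (λ i → ⟦ 𝐔 i ⟧ * f i) (λ i → ⟦ 𝐑 i ⟧ * f i + ⟦ 𝐖 i ⟧ * f i))
             (cong (_+_ (over 𝐔 f)) (sum-+ (λ i → ⟦ 𝐑 i ⟧ * f i) (λ i → ⟦ 𝐖 i ⟧ * f i))))
      where
      split : ∀ x P → x ≡ ⟦ isU P ⟧ * x + (⟦ isR P ⟧ * x + ⟦ isW P ⟧ * x)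
      split x U = sym (trans (+-identityʳ _) (+-identityʳ x))
      split x B = sym (+-identityʳ x)
      split x V = sym (+-identityʳ x)
      split x R = sym (trans (+-identityʳ _) (+-identityʳ x))

    size : α + (ρ + β) ≡ n
    size = trans (sym (cong₂ _+_ (over-one 𝐔) (cong₂ _+_ (over-one 𝐑) (over-one 𝐖))))
      (trans (sym (total-split (λ _ → 1))) (trans (sum-const n 1) (*-identityʳ n)))

    dU dR dB dV dW : Vector ℕ n
    dU i = over 𝐔 λ j → ⟦ h i j ⟧
    dR i = over 𝐑 λ j → ⟦ h i j ⟧
    dB i = over 𝐁 λ j → ⟦ h i j ⟧
    dV i = over 𝐕 λ j → ⟦ h i j ⟧
    dW i = over 𝐖 λ j → ⟦ h i j ⟧

    over-all : (P : Fin n → Bool) {f : Vector ℕ n} → (∀ i → P i ≡ true → f i ≡ 1) → over P f ≡ card P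
    over-all P f≡1 = trans (over-cong P f≡1) (over-one P)

    over-none : (P : Fin n → Bool) {f : Vector ℕ n} → (∀ i → P i ≡ true → f i ≡ 0) → over P f ≡ 0
    over-none P f≡0 = trans (over-cong P f≡0) (trans (over-const P 0) (*-zeroʳ (card P)))

    -- Each vertex is its own only non-neighbour in a clique, so adding the unit
    -- vector at i to row i makes it constantly 1 there.
    over-clique : (P : Fin n → Bool) (i : Fin n) → P i ≡ true →
      (∀ j → P j ≡ true → i ≢ j → h i j ≡ true) → over P (λ j → ⟦ h i j ⟧) + 1 ≡ card P
    over-clique P i Pi clique = trans (cong (_+_ (over P (λ j → ⟦ h i j ⟧))) (sym (over-point P i Pi)))
      (trans (sym (over-+ P (λ j → ⟦ h i j ⟧) (e i))) (over-all P one))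
      where
      one : ∀ j → P j ≡ true → ⟦ h i j ⟧ + e i j ≡ 1
      one j Pj with i ≟ j
      ... | yes refl rewrite irr i = refl
      ... | no i≢j rewrite clique j Pj i≢j = refl

    U-row : ∀ i → part i ≡ U → deg h i + 1 ≡ α + ρ + dW i
    U-row i i∈U = trans (cong (_+ 1) (total-split λ j → ⟦ h i j ⟧)) (trans (rearrange (dU i) (dR i) (dW i))
      (cong₂ (λ x y → x + y + dW i)
        (over-clique 𝐔 i (cong isU i∈U) λ j j∈U → UU i j i∈U (toU j∈U))
        (over-all 𝐑 λ j j∈R → cong ⟦_⟧ (UR i j i∈U (toR j∈R)))))
      where
      rearrange : ∀ x y z → x + (y + z) + 1 ≡ x + 1 + y + z
      rearrange = solve-∀

    W-row : ∀ i → 𝐖 i ≡ true → deg h i ≡ dU i + dR i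
    W-row i i∈W = trans (total-split λ j → ⟦ h i j ⟧) (cong (_+_ (dU i))
      (trans (cong (_+_ (dR i)) (over-none 𝐖 λ j j∈W → cong ⟦_⟧ (WW i j i∈W j∈W))) (+-identityʳ _)))

    R-row : ∀ i → part i ≡ R → deg h i ≡ α + dR i + dW i
    R-row i i∈R = trans (total-split λ j → ⟦ h i j ⟧) (trans (sym (+-assoc (dU i) (dR i) (dW i)))
      (cong (λ x → x + dR i + dW i) (over-all 𝐔 λ j j∈U →
        cong ⟦_⟧ (trans (symm i j) (UR j i (toU j∈U) i∈R)))))

    dR≤ : ∀ i → part i ≡ R → dR i + 1 ≤ ρ
    dR≤ i i∈R = ≤-trans (≤-reflexive (trans (cong (_+_ (dR i)) (sym (over-point 𝐑 i (cong isR i∈R))))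
        (sym (over-+ 𝐑 (λ j → ⟦ h i j ⟧) (e i)))))
      (≤-trans (over-mono 𝐑 {g = λ _ → 1} λ j _ → one j) (≤-reflexive (over-one 𝐑)))
      where
      one : ∀ j → ⟦ h i j ⟧ + e i j ≤ 1
      one j with i ≟ j
      ... | yes refl rewrite irr i = ≤-refl
      ... | no _ = ≤-trans (≤-reflexive (+-identityʳ _)) (⟦⟧≤1 (h i j))

    ≢B : ∀ {u i} → part u ≡ B → part i ≡ U → e u i ≡ 0
    ≢B {u} {i} u∈B i∈U = e-off {u = u} {i} λ { refl → case (trans (sym u∈B) i∈U) }
      where
      case : B ≢ U
      case ()

    U-degree : ∀ i → part i ≡ U → deg h i ≤ c₁
    U-degree i i∈U = ≤-trans (≤-reflexive (trans (degrees i)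
      (trans (cong₂ (λ x y → D i + x + y) (≢B p∈B i∈U) (≢B q∈B i∈U)) (trans (+-identityʳ _) (+-identityʳ _))))) (upper i)

    -- `p` and `q` lie in `B`, so on `U` the degrees of `h` are those of `D`. The last `α` pays for
    -- the diagonal: on the left each clique vertex counts as its own neighbour.
    h₁ : α * (α + ρ) + X ≤ c₁ * α + α
    h₁ = begin
      α * (α + ρ) + X                       ≡⟨ cong (_+ X) (over-const 𝐔 (α + ρ)) ⟨
      over 𝐔 (λ _ → α + ρ) + X              ≡⟨ over-+ 𝐔 (λ _ → α + ρ) dW ⟨
      over 𝐔 (λ i → α + ρ + dW i)           ≤⟨ over-mono 𝐔 (λ i i∈U → ≤-trans (≤-reflexive (sym (U-row i (toU i∈U)))) (+-monoˡ-≤ 1 (U-degree i (toU i∈U)))) ⟩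
      over 𝐔 (λ _ → c₁ + 1)                 ≡⟨ over-const 𝐔 (c₁ + 1) ⟩
      α * (c₁ + 1)                          ≡⟨ rearrange α c₁ ⟩
      c₁ * α + α                            ∎
      where
      open ≤-Reasoning
      rearrange : ∀ x y → x * (y + 1) ≡ y * x + x
      rearrange = solve-∀

    -- The 2 is the surplus of `p` and `q`, whose rows belong to `B`; edges from `B` go only to `U`
    -- and `R`. Rows of `V` are charged for their neighbours in `U` alone, which `VU` permits, so
    -- `ε` stays out.
    h₂ : c₂ * β + 2 ≤ X + θ
    h₂ = begin
      c₂ * β + 2                                   ≡⟨ cong (λ x → c₂ * x + 2) β≡ ⟩
      c₂ * (card 𝐁 + card 𝐕) + 2                   ≡⟨ rearrange c₂ (card 𝐁) (card 𝐕) ⟩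
      card 𝐁 * c₂ + 1 + 1 + card 𝐕 * c₂            ≡⟨ cong₂ (λ x y → x + 1 + 1 + y) (over-const 𝐁 c₂) (over-const 𝐕 c₂) ⟨
      over 𝐁 (λ _ → c₂) + 1 + 1 + over 𝐕 (λ _ → c₂) ≤⟨ +-mono-≤ (+-monoˡ-≤ 1 (+-monoˡ-≤ 1 (over-mono 𝐁 λ i _ → lower i))) (over-mono 𝐕 λ i i∈V → VU i (toV i∈V)) ⟩
      over 𝐁 D + 1 + 1 + over 𝐕 dU                 ≡⟨ cong₂ (λ x y → over 𝐁 D + x + y + over 𝐕 dU) (over-point 𝐁 p (cong isB p∈B)) (over-point 𝐁 q (cong isB q∈B)) ⟨
      over 𝐁 D + over 𝐁 (e p) + over 𝐁 (e q) + over 𝐕 dU ≡⟨ cong (λ x → x + over 𝐁 (e q) + over 𝐕 dU) (over-+ 𝐁 D (e p)) ⟨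
      over 𝐁 (λ i → D i + e p i) + over 𝐁 (e q) + over 𝐕 dU ≡⟨ cong (_+ over 𝐕 dU) (over-+ 𝐁 (λ i → D i + e p i) (e q)) ⟨
      over 𝐁 (λ i → D i + e p i + e q i) + over 𝐕 dU ≡⟨ cong (_+ over 𝐕 dU) (over-cong 𝐁 (λ i i∈B → trans (sym (degrees i)) (W-row i (B⊆W i∈B)))) ⟩
      over 𝐁 (λ i → dU i + dR i) + over 𝐕 dU       ≡⟨ cong (_+ over 𝐕 dU) (over-+ 𝐁 dU dR) ⟩
      over 𝐁 dU + over 𝐁 dR + over 𝐕 dU            ≡⟨ rearrange′ (over 𝐁 dU) (over 𝐁 dR) (over 𝐕 dU) ⟩
      over 𝐁 dU + over 𝐕 dU + over 𝐁 dR            ≡⟨ cong₂ _+_ (trans (sym (W-split dU)) (edges-comm simple 𝐖 𝐔)) (edges-comm simple 𝐁 𝐑) ⟩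
      X + θ                                        ∎
      where
      open ≤-Reasoning
      β≡ : β ≡ card 𝐁 + card 𝐕
      β≡ = trans (sym (over-one 𝐖)) (trans (W-split λ _ → 1)
        (cong₂ _+_ (over-one 𝐁) (over-one 𝐕)))
      rearrange : ∀ c x y → c * (x + y) + 2 ≡ x * c + 1 + 1 + y * c
      rearrange = solve-∀
      rearrange′ : ∀ x y z → x + y + z ≡ x + z + y
      rearrange′ = solve-∀

    U-sum : over 𝐔 (deg h) + α ≡ α * (α + ρ) + X
    U-sum = begin
      over 𝐔 (deg h) + α                  ≡⟨ cong (_+_ (over 𝐔 (deg h))) (over-one 𝐔) ⟨
      over 𝐔 (deg h) + over 𝐔 (λ _ → 1)   ≡⟨ over-+ 𝐔 (deg h) (λ _ → 1) ⟨
      over 𝐔 (λ i → deg h i + 1)          ≡⟨ over-cong 𝐔 (λ i i∈U → U-row i (toU i∈U)) ⟩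
      over 𝐔 (λ i → α + ρ + dW i)         ≡⟨ over-+ 𝐔 (λ _ → α + ρ) dW ⟩
      over 𝐔 (λ _ → α + ρ) + X            ≡⟨ cong (_+ X) (over-const 𝐔 (α + ρ)) ⟩
      α * (α + ρ) + X                     ∎
      where open ≡-Reasoning

    RW≡ : over 𝐑 dW ≡ θ + ε
    RW≡ = trans (over-cong 𝐑 λ i _ → W-split λ j → ⟦ h i j ⟧) (over-+ 𝐑 dB dV)

    W-sum : over 𝐖 (deg h) ≡ X + (θ + ε)
    W-sum = trans (over-cong 𝐖 W-row) (trans (over-+ 𝐖 dU dR)
      (cong₂ _+_ (edges-comm simple 𝐖 𝐔) (trans (edges-comm simple 𝐖 𝐑) RW≡)))

    R-sum : over 𝐑 (deg h) ≡ ρ * α + edges h 𝐑 𝐑 + (θ + ε)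
    R-sum = trans (over-cong 𝐑 λ i i∈R → R-row i (toR i∈R)) (trans (over-+ 𝐑 (λ i → α + dR i) dW)
      (cong₂ _+_ (trans (over-+ 𝐑 (λ _ → α) dR) (cong (_+ edges h 𝐑 𝐑) (over-const 𝐑 α))) RW≡))

    RR≤ : edges h 𝐑 𝐑 + ρ ≤ ρ * ρ
    RR≤ = begin
      edges h 𝐑 𝐑 + ρ                    ≡⟨ cong (_+_ (edges h 𝐑 𝐑)) (over-one 𝐑) ⟨
      edges h 𝐑 𝐑 + over 𝐑 (λ _ → 1)     ≡⟨ over-+ 𝐑 dR (λ _ → 1) ⟨
      over 𝐑 (λ i → dR i + 1)            ≤⟨ over-mono 𝐑 (λ i i∈R → dR≤ i (toR i∈R)) ⟩
      over 𝐑 (λ _ → ρ)                   ≡⟨ over-const 𝐑 ρ ⟩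
      ρ * ρ                              ∎
      where open ≤-Reasoning

    -- The 2 is the surplus and `α` again the diagonal of the clique. The edges inside `R` keep a
    -- term of their own: `h₃` drops it together with `ε`, and `h₄` replaces it by the complete
    -- graph on `R`.
    handshake : sumℕ D + 2 + α ≡ α * (α + ρ) + 2 * X + ρ * α + edges h 𝐑 𝐑 + 2 * (θ + ε)
    handshake = begin
      sumℕ D + 2 + α                                                 ≡⟨ cong (_+ α) sum-deg ⟨
      sumℕ (deg h) + α                                               ≡⟨ cong (_+ α) (total-split (deg h)) ⟩
      over 𝐔 (deg h) + (over 𝐑 (deg h) + over 𝐖 (deg h)) + α         ≡⟨ rearrange (over 𝐔 (deg h)) _ α ⟩
      over 𝐔 (deg h) + α + (over 𝐑 (deg h) + over 𝐖 (deg h))         ≡⟨ cong₂ _+_ U-sum (cong₂ _+_ R-sum W-sum) ⟩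
      α * (α + ρ) + X + (ρ * α + edges h 𝐑 𝐑 + (θ + ε) + (X + (θ + ε))) ≡⟨ rearrange′ (α * (α + ρ)) X (ρ * α) (edges h 𝐑 𝐑) (θ + ε) ⟩
      α * (α + ρ) + 2 * X + ρ * α + edges h 𝐑 𝐑 + 2 * (θ + ε)        ∎
      where
      open ≡-Reasoning
      rearrange : ∀ x y z → x + y + z ≡ x + z + y
      rearrange = solve-∀
      rearrange′ : ∀ a x b r t → a + x + (b + r + t + (x + t)) ≡ a + 2 * x + b + r + 2 * t
      rearrange′ = solve-∀
      sum-deg : sumℕ (deg h) ≡ sumℕ D + 2
      sum-deg = trans (sum-cong-≗ degrees) (trans (sum-+ (λ i → D i + e p i) (e q))
        (trans (cong₂ _+_ (trans (sum-+ D (e p)) (cong (_+_ (sumℕ D)) (sum-e p))) (sum-e q)) (+-assoc (sumℕ D) 1 1)))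

    h₃ : α * α + 2 * (α * ρ) + 2 * (X + θ) ≤ sumℕ D + 2 + α
    h₃ = begin
      α * α + 2 * (α * ρ) + 2 * (X + θ)                              ≤⟨ m≤m+n _ (edges h 𝐑 𝐑 + 2 * ε) ⟩
      α * α + 2 * (α * ρ) + 2 * (X + θ) + (edges h 𝐑 𝐑 + 2 * ε)      ≡⟨ rearrange α ρ X θ (edges h 𝐑 𝐑) ε ⟩
      α * (α + ρ) + 2 * X + ρ * α + edges h 𝐑 𝐑 + 2 * (θ + ε)        ≡⟨ handshake ⟨
      sumℕ D + 2 + α                                                 ∎
      where
      open ≤-Reasoning
      rearrange : ∀ α ρ X θ r ε → α * α + 2 * (α * ρ) + 2 * (X + θ) + (r + 2 * ε) ≡ α * (α + ρ) + 2 * X + ρ * α + r + 2 * (θ + ε)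
      rearrange = solve-∀

    h₄ : sumℕ D + 2 + (α + ρ) ≤ α * α + 2 * (α * ρ) + 2 * (X + θ + ε) + ρ * ρ
    h₄ = begin
      sumℕ D + 2 + (α + ρ)                                               ≡⟨ +-assoc (sumℕ D + 2) α ρ ⟨
      sumℕ D + 2 + α + ρ                                                 ≡⟨ cong (_+ ρ) handshake ⟩
      α * (α + ρ) + 2 * X + ρ * α + edges h 𝐑 𝐑 + 2 * (θ + ε) + ρ        ≡⟨ rearrange α ρ X θ (edges h 𝐑 𝐑) ε ⟩
      α * α + 2 * (α * ρ) + 2 * (X + θ + ε) + (edges h 𝐑 𝐑 + ρ)          ≤⟨ +-monoʳ-≤ (α * α + 2 * (α * ρ) + 2 * (X + θ + ε)) RR≤ ⟩
      α * α + 2 * (α * ρ) + 2 * (X + θ + ε) + ρ * ρ                      ∎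
      where
      open ≤-Reasoning
      rearrange : ∀ α ρ X θ r ε → α * (α + ρ) + 2 * X + ρ * α + r + 2 * (θ + ε) + ρ ≡ α * α + 2 * (α * ρ) + 2 * (X + θ + ε) + (r + ρ)
      rearrange = solve-∀

    -- The dominating `u` sees `p` besides all neighbours of `i` in `V`. This extra neighbour makes
    -- up for the 1 by which `u` misses itself in the clique, and the degree of `u` is at most `c₁`.
    dV≤ : ∀ i → part i ≡ R → α + ρ + dV i ≤ c₁
    dV≤ i i∈R with R-domin i i∈R
    ... | u , u∈U , u~p , V⊆ = +-cancelʳ-≤ 1 _ _ (begin
      α + ρ + dV i + 1               ≤⟨ ≤-reflexive (+-assoc (α + ρ) (dV i) 1) ⟩
      α + ρ + (dV i + 1)             ≤⟨ +-monoʳ-≤ (α + ρ) dV+1≤dW ⟩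
      α + ρ + dW u                   ≡⟨ U-row u u∈U ⟨
      deg h u + 1                    ≤⟨ +-monoˡ-≤ 1 (U-degree u u∈U) ⟩
      c₁ + 1                         ∎)
      where
      open ≤-Reasoning
      dV+1≤dW : dV i + 1 ≤ dW u
      dV+1≤dW = begin
        dV i + 1              ≤⟨ +-mono-≤ (over-mono 𝐕 {g = λ j → ⟦ h u j ⟧} λ j j∈V → mono j (toV j∈V)) one ⟩
        dV u + dB u           ≡⟨ +-comm (dV u) (dB u) ⟩
        dB u + dV u           ≡⟨ W-split (λ j → ⟦ h u j ⟧) ⟨
        dW u                  ∎
        where
        mono : ∀ j → part j ≡ V → ⟦ h i j ⟧ ≤ ⟦ h u j ⟧
        mono j j∈V with h i j in i~j
        ... | false = z≤n
        ... | true rewrite V⊆ j j∈V i~j = ≤-refl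
        one : 1 ≤ dB u
        one = ≤-trans (≤-reflexive (sym (cong₂ (λ x y → ⟦ x ⟧ * ⟦ y ⟧) (cong isB p∈B) u~p)))
                      (≤-sum (λ j → ⟦ 𝐁 j ⟧ * ⟦ h u j ⟧) p)

    h₅ : α * ρ + ρ * ρ + ε ≤ c₁ * ρ
    h₅ = begin
      α * ρ + ρ * ρ + ε                   ≡⟨ cong (_+ ε) (rearrange α ρ) ⟩
      ρ * (α + ρ) + ε                     ≡⟨ cong (_+ ε) (over-const 𝐑 (α + ρ)) ⟨
      over 𝐑 (λ _ → α + ρ) + ε            ≡⟨ over-+ 𝐑 (λ _ → α + ρ) dV ⟨
      over 𝐑 (λ i → α + ρ + dV i)         ≤⟨ over-mono 𝐑 (λ i i∈R → dV≤ i (toR i∈R)) ⟩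
      over 𝐑 (λ _ → c₁)                   ≡⟨ over-const 𝐑 c₁ ⟩
      ρ * c₁                              ≡⟨ *-comm ρ c₁ ⟩
      c₁ * ρ                              ∎
      where
      open ≤-Reasoning
      rearrange : ∀ x y → x * y + y * y ≡ y * (x + y)
      rearrange = solve-∀

    ⟦⟧*≤1 : ∀ x {y} → y ≤ 1 → ⟦ x ⟧ * y ≤ 1
    ⟦⟧*≤1 true  y≤1 = ≤-trans (≤-reflexive (*-identityˡ _)) y≤1
    ⟦⟧*≤1 false y≤1 = z≤n

    dB≤1 : ∀ i → part i ≡ R → dB i ≤ 1
    dB≤1 i i∈R = sum-unit (λ j → ⟦⟧*≤1 (𝐁 j) (⟦⟧≤1 (h i j))) unique
      where
      unique : ∀ j k → 0 < ⟦ 𝐁 j ⟧ * ⟦ h i j ⟧ → 0 < ⟦ 𝐁 k ⟧ * ⟦ h i k ⟧ → j ≡ k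
      unique j k 0<j 0<k with ⟦⟧*⟦⟧-positive (𝐁 j) (h i j) 0<j | ⟦⟧*⟦⟧-positive (𝐁 k) (h i k) 0<k
      ... | j∈B , i~j | k∈B , i~k = proj₁ (BR j i k i (toB j∈B) i∈R i~j (toB k∈B) i∈R i~k)

    θ≤1 : θ ≤ 1
    θ≤1 = sum-unit bound unique
      where
      bound : ∀ i → ⟦ 𝐑 i ⟧ * dB i ≤ 1
      bound i with 𝐑 i in i∈R
      ... | true  = ≤-trans (≤-reflexive (*-identityˡ (dB i))) (dB≤1 i (toR i∈R))
      ... | false = z≤n
      unique : ∀ i j → 0 < ⟦ 𝐑 i ⟧ * dB i → 0 < ⟦ 𝐑 j ⟧ * dB j → i ≡ j
      unique i j 0<i 0<j with ⟦⟧*-positive (𝐑 i) 0<i | ⟦⟧*-positive (𝐑 j) 0<j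
      ... | i∈R , 0<dBi | j∈R , 0<dBj
        with sum-positive (λ k → ⟦ 𝐁 k ⟧ * ⟦ h i k ⟧) 0<dBi | sum-positive (λ k → ⟦ 𝐁 k ⟧ * ⟦ h j k ⟧) 0<dBj
      ...   | k , 0<k | l , 0<l with ⟦⟧*⟦⟧-positive (𝐁 k) (h i k) 0<k | ⟦⟧*⟦⟧-positive (𝐁 l) (h j l) 0<l
      ...     | k∈B , i~k | l∈B , j~l =
        proj₂ (BR k i l j (toB k∈B) (toR i∈R) i~k (toB l∈B) (toR j∈R) j~l)

    θ≤ρ : θ ≤ ρ
    θ≤ρ = ≤-trans (over-mono 𝐑 λ i i∈R → dB≤1 i (toR i∈R)) (≤-reflexive (over-one 𝐑))

    X≤αβ : X ≤ α * β
    X≤αβ = ≤-trans (over-mono 𝐔 λ i _ → ≤-trans (over-mono 𝐖 {g = λ _ → 1} λ j _ → ⟦⟧≤1 (h i j))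
        (≤-reflexive (over-one 𝐖)))
      (≤-reflexive (over-const 𝐔 β))

  no-obstruction : 0 < c₂ → c₂ ≤ c₁ → c₁ < n → 2 ∣ sumℕ D → sumℕ D ≤ n * c₁ → n * c₂ ≤ sumℕ D →
    FullyGraphic (𝔻 n (sumℕ D) c₁ c₂) → ⊥
  no-obstruction 0<c₂ c₂≤c₁ c₁<n even Σ≤ ≤Σ fg =
    no-tight-partition 0<c₂ c₂≤c₁ c₁<n even Σ≤ ≤Σ fg α β ρ X θ ε size h₁ h₂ h₃ h₄ h₅ θ≤1 θ≤ρ X≤αβ

-- Toggling pairs

-- The condition `u ≢ v` makes a loop toggle nothing, so trails of every length can be padded to
-- lists of one fixed shape.
Hits : (u v i j : Fin n) → Set
Hits u v i j = u ≢ v × (u ≡ i × v ≡ j ⊎ u ≡ j × v ≡ i)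

hits? : (u v i j : Fin n) → Dec (Hits u v i j)
hits? u v i j = ¬? (u ≟ v) ×-dec ((u ≟ i ×-dec v ≟ j) ⊎-dec (u ≟ j ×-dec v ≟ i))

toggle : Fin n → Fin n → Adj n → Adj n
toggle u v g i j = does (hits? u v i j) xor g i j

toggles : List (Fin n × Fin n) → Adj n → Adj n
toggles []            g = g
toggles ((u , v) ∷ L) g = toggles L (toggle u v g)

toggle-miss : ∀ {u v i j : Fin n} (g : Adj n) → ¬ Hits u v i j → toggle u v g i j ≡ g i j
toggle-miss {u = u} {v} {i} {j} g miss = cong (_xor g i j) (dec-false (hits? u v i j) miss)

toggle-hit : ∀ {u v i j : Fin n} (g : Adj n) → Hits u v i j → toggle u v g i j ≡ not (g i j)
toggle-hit {u = u} {v} {i} {j} g hit = cong (_xor g i j) (dec-true (hits? u v i j) hit)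

toggles-miss : ∀ L {i j : Fin n} (g : Adj n) → All (λ (u , v) → ¬ Hits u v i j) L → toggles L g i j ≡ g i j
toggles-miss []            g []              = refl
toggles-miss ((u , v) ∷ L) g (miss ∷ misses) = trans (toggles-miss L (toggle u v g) misses) (toggle-miss g miss)

hits-swap : ∀ {u v i j : Fin n} → Hits u v i j → Hits u v j i
hits-swap (u≢v , inj₁ eqs) = u≢v , inj₂ eqs
hits-swap (u≢v , inj₂ eqs) = u≢v , inj₁ eqs

toggle-simple : ∀ (u v : Fin n) {g} → Simple g → Simple (toggle u v g)
toggle-simple u v {g} simple = record { symm = symm′ ; irr = irr′ }
  where
  open Simple simple
  symm′ : ∀ i j → toggle u v g i j ≡ toggle u v g j i
  symm′ i j = by-cases (hits? u v i j)
    where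
    by-cases : Dec (Hits u v i j) → toggle u v g i j ≡ toggle u v g j i
    by-cases (yes hit) = trans (toggle-hit g hit) (trans (cong not (symm i j)) (sym (toggle-hit g (hits-swap hit))))
    by-cases (no miss) = trans (toggle-miss g miss) (trans (symm i j) (sym (toggle-miss g (miss ∘ hits-swap))))
  irr′ : ∀ i → toggle u v g i i ≡ false
  irr′ i = trans (toggle-miss g loop) (irr i)
    where
    loop : ¬ Hits u v i i
    loop (u≢v , inj₁ (refl , refl)) = u≢v refl
    loop (u≢v , inj₂ (refl , refl)) = u≢v refl

toggles-simple : ∀ (L : List (Fin n × Fin n)) {g} → Simple g → Simple (toggles L g)
toggles-simple []            simple = simple
toggles-simple ((u , v) ∷ L) simple = toggles-simple L (toggle-simple u v simple)

-- A list acts as xor with a fixed mask, namely what it makes of the empty graph. Congruence and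
-- involutivity then reduce to laws of xor.
toggles-xor : ∀ (L : List (Fin n × Fin n)) g i j → toggles L g i j ≡ toggles L (λ _ _ → false) i j xor g i j
toggles-xor []            g i j = refl
toggles-xor ((u , v) ∷ L) g i j = begin
  toggles L (toggle u v g) i j             ≡⟨ toggles-xor L (toggle u v g) i j ⟩
  toggles L ∅ i j xor (m xor g i j)        ≡⟨ xor-assoc (toggles L ∅ i j) m (g i j) ⟨
  (toggles L ∅ i j xor m) xor g i j        ≡⟨ cong (λ x → (toggles L ∅ i j xor x) xor g i j) (xor-identityʳ m) ⟨
  (toggles L ∅ i j xor (m xor false)) xor g i j ≡⟨ cong (_xor g i j) (toggles-xor L (toggle u v ∅) i j) ⟨
  toggles L (toggle u v ∅) i j xor g i j   ∎
  where
  open ≡-Reasoning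
  ∅ : Adj _
  ∅ _ _ = false
  m = does (hits? u v i j)

toggles-cong : ∀ (L : List (Fin n × Fin n)) {g g′} → (∀ i j → g i j ≡ g′ i j) → ∀ i j → toggles L g i j ≡ toggles L g′ i j
toggles-cong L {g} {g′} g≗g′ i j = trans (toggles-xor L g i j)
  (trans (cong (toggles L (λ _ _ → false) i j xor_) (g≗g′ i j)) (sym (toggles-xor L g′ i j)))

toggles-involutive : ∀ (L : List (Fin n × Fin n)) g i j → toggles L (toggles L g) i j ≡ g i j
toggles-involutive L g i j = trans (toggles-xor L (toggles L g) i j)
  (trans (cong (t xor_) (toggles-xor L g i j))
  (trans (sym (xor-assoc t t (g i j))) (cong (_xor g i j) (xor-same t))))
  where t = toggles L (λ _ _ → false) i j

deg-cong : {g g′ : Adj n} → (∀ i j → g i j ≡ g′ i j) → ∀ i → deg g i ≡ deg g′ i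
deg-cong g≗g′ i = sum-cong-≗ λ j → cong ⟦_⟧ (g≗g′ i j)

-- With respect to the pair {u, v}, toggling changes entry (i, j) by the product
-- of unit vectors e u i * e v j + e v i * e u j.
toggle-entries : ∀ {u v : Fin n} {g g′ : Adj n} → Simple g → u ≢ v →
  g u v ≡ false → g′ u v ≡ true → g′ v u ≡ true → (∀ i j → ¬ Hits u v i j → g′ i j ≡ g i j) →
  ∀ i → deg g′ i ≡ deg g i + e u i + e v i
toggle-entries {n} {u} {v} {g} {g′} simple u≢v guv g′uv g′vu same i = begin
  deg g′ i                                                                   ≡⟨ sum-cong-≗ entry ⟩
  sumℕ (λ j → ⟦ g i j ⟧ + e u i * e v j + e v i * e u j)                     ≡⟨ sum-+ (λ j → ⟦ g i j ⟧ + e u i * e v j) (λ j → e v i * e u j) ⟩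
  sumℕ (λ j → ⟦ g i j ⟧ + e u i * e v j) + sumℕ (λ j → e v i * e u j)        ≡⟨ cong₂ _+_ (sum-+ (λ j → ⟦ g i j ⟧) (λ j → e u i * e v j)) (unit v u) ⟩
  deg g i + sumℕ (λ j → e u i * e v j) + e v i                               ≡⟨ cong (λ x → deg g i + x + e v i) (unit u v) ⟩
  deg g i + e u i + e v i                                                    ∎
  where
  open ≡-Reasoning
  open Simple simple
  unit : ∀ x y → sumℕ (λ j → e x i * e y j) ≡ e x i
  unit x y = trans (sum-*ˡ (e x i) (e y)) (trans (cong (e x i *_) (sum-e y)) (*-identityʳ _))
  entry : ∀ j → ⟦ g′ i j ⟧ ≡ ⟦ g i j ⟧ + e u i * e v j + e v i * e u j
  entry j with hits? u v i j
  ... | yes (_ , inj₁ (refl , refl)) rewrite g′uv | guv | e-diag u | e-diag v | e-off (u≢v ∘ sym) = refl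
  ... | yes (_ , inj₂ (refl , refl)) rewrite g′vu | symm v u | guv | e-diag u | e-diag v | e-off u≢v = refl
  ... | no miss rewrite same i j miss = sym (trans (cong₂ (λ x y → ⟦ g i j ⟧ + x + y) (off λ eqs → miss (u≢v , inj₁ eqs))
      (trans (*-comm (e v i) (e u j)) (off λ eqs → miss (u≢v , inj₂ eqs))))
      (trans (+-identityʳ _) (+-identityʳ _)))
    where
    off : ∀ {k l} → ¬ (u ≡ k × v ≡ l) → e u k * e v l ≡ 0
    off {k} {l} distinct with u ≟ k | v ≟ l
    ... | yes u≡k | yes v≡l = contradiction (u≡k , v≡l) distinct
    ... | yes _   | no _    = refl
    ... | no _    | _       = refl

deg-add : ∀ {u v : Fin n} {g} → Simple g → u ≢ v → g u v ≡ false →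
  ∀ i → deg (toggle u v g) i ≡ deg g i + e u i + e v i
deg-add {g = g} simple u≢v guv = toggle-entries simple u≢v guv
  (trans (toggle-hit g (u≢v , inj₁ (refl , refl))) (cong not guv))
  (trans (toggle-hit g (u≢v , inj₂ (refl , refl))) (cong not (trans (Simple.symm simple _ _) guv)))
  λ i j miss → toggle-miss g miss

adjacent⇒≢ : ∀ {u v : Fin n} {g} → Simple g → g u v ≡ true → u ≢ v
adjacent⇒≢ simple guv refl with () ← trans (sym guv) (Simple.irr simple _)

deg-remove : ∀ {u v : Fin n} {g} → Simple g → g u v ≡ true →
  ∀ i → deg g i ≡ deg (toggle u v g) i + e u i + e v i
deg-remove {u = u} {v} {g} simple guv = toggle-entries (toggle-simple u v simple) u≢v
  (trans (toggle-hit g (u≢v , inj₁ (refl , refl))) (cong not guv))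
  guv (trans (Simple.symm simple _ _) guv) λ i j miss → sym (toggle-miss g miss)
  where u≢v = adjacent⇒≢ simple guv

loop-misses : ∀ {u i j : Fin n} → ¬ Hits u u i j
loop-misses (u≢u , _) = u≢u refl

toggle-loop : ∀ (u : Fin n) g i j → toggle u u g i j ≡ g i j
toggle-loop u g i j = toggle-miss {u = u} {u} {i} {j} g loop-misses

deg-loop : ∀ (u : Fin n) g i → deg (toggle u u g) i ≡ deg g i
deg-loop u g = deg-cong (toggle-loop u g)

-- An edge and a non-edge are never the same pair, so along an alternating trail only pairs of the
-- same kind have to be told apart by their endpoints, as in the four lemmas that follow.
value-misses : ∀ {g : Adj n} {u v i j} → Simple g → g u v ≢ g i j → ¬ Hits u v i j
value-misses simple differ (_ , inj₁ (refl , refl)) = differ refl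
value-misses simple differ (_ , inj₂ (refl , refl)) = differ (Simple.symm simple _ _)

left-misses : ∀ {u v i j : Fin n} → u ≢ i → u ≢ j → ¬ Hits u v i j
left-misses u≢i u≢j (_ , inj₁ (u≡i , _)) = u≢i u≡i
left-misses u≢i u≢j (_ , inj₂ (u≡j , _)) = u≢j u≡j

right-misses : ∀ {u v i j : Fin n} → v ≢ i → v ≢ j → ¬ Hits u v i j
right-misses v≢i v≢j (_ , inj₁ (_ , v≡j)) = v≢j v≡j
right-misses v≢i v≢j (_ , inj₂ (_ , v≡i)) = v≢i v≡i

first-misses : ∀ {u v i j : Fin n} → u ≢ i → v ≢ i → ¬ Hits u v i j
first-misses u≢i v≢i (_ , inj₁ (u≡i , _)) = u≢i u≡i
first-misses u≢i v≢i (_ , inj₂ (_ , v≡i)) = v≢i v≡i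

second-misses : ∀ {u v i j : Fin n} → u ≢ j → v ≢ j → ¬ Hits u v i j
second-misses u≢j v≢j (_ , inj₁ (_ , v≡j)) = v≢j v≡j
second-misses u≢j v≢j (_ , inj₂ (u≡j , _)) = u≢j u≡j

true≢false : ∀ {x y} → x ≡ true → y ≡ false → x ≢ y
true≢false refl refl ()

false≢true : ∀ {x y} → x ≡ false → y ≡ true → x ≢ y
false≢true refl refl ()

-- Root trails and middle trails

root-path : (s u b w : Fin n) → List (Fin n × Fin n)
root-path s u b w = (s , u) ∷ (u , b) ∷ (b , w) ∷ []

middle-path : (w₁ z₁ z₂ z₃ z₄ w₂ : Fin n) → List (Fin n × Fin n)
middle-path w₁ z₁ z₂ z₃ z₄ w₂ = (w₁ , z₁) ∷ (z₁ , z₂) ∷ (z₂ , z₃) ∷ (z₃ , z₄) ∷ (z₄ , w₂) ∷ []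

-- Alternating trails from s to w of length 1 or 3 that start and end with an
-- edge. A short trail is padded to the common length with loops, which toggle
-- nothing.
data Root (g : Adj n) (s w : Fin n) : (u b : Fin n) → Set where
  direct : g s w ≡ true → Root g s w s s
  via    : ∀ {u b} → g s u ≡ true → g u b ≡ false → g b w ≡ true → s ≢ b → u ≢ b → Root g s w u b

-- Each visit to an inner vertex removes one edge and adds another, so only the two ends lose
-- degree.
root-degree : ∀ {g : Adj n} {s w u b} → Simple g → Root g s w u b →
  ∀ i → deg g i ≡ deg (toggles (root-path s u b w) g) i + e w i + e s i
root-degree {n} {g} {s} {w} simple (direct gsw) i = begin
  deg g i                                         ≡⟨ trans (deg-loop s g₁ i) (deg-loop s g i) ⟨
  deg g₂ i                                        ≡⟨ deg-remove (toggle-simple s s (toggle-simple s s simple)) g₂sw i ⟩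
  deg (toggle s w g₂) i + e s i + e w i           ≡⟨ swap (deg (toggle s w g₂) i) (e s i) (e w i) ⟩
  deg (toggle s w g₂) i + e w i + e s i           ∎
  where
  open ≡-Reasoning
  g₁ g₂ : Adj n
  g₁ = toggle s s g
  g₂ = toggle s s g₁
  g₂sw : g₂ s w ≡ true
  g₂sw = trans (toggle-loop s g₁ s w) (trans (toggle-loop s g s w) gsw)
  swap : ∀ x y z → x + y + z ≡ x + z + y
  swap = solve-∀
root-degree {n} {g} {s} {w} {u} {b} simple (via gsu gub gbw s≢b u≢b) i = begin
  deg g i                                             ≡⟨ deg-remove simple gsu i ⟩
  -- The unit at `b` is gained before it is lost; carrying `e b i` on both sides and cancelling it
  -- avoids truncated subtraction.
  deg g₁ i + e s i + e u i                            ≡⟨ +-cancelʳ-≡ (e b i) _ _ (begin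
    deg g₁ i + e s i + e u i + e b i                    ≡⟨ rearrange (deg g₁ i) (e s i) (e u i) (e b i) ⟩
    deg g₁ i + e u i + e b i + e s i                    ≡⟨ cong (_+ e s i) (deg-add simple₁ u≢b g₁ub i) ⟨
    deg g₂ i + e s i                                    ≡⟨ cong (_+ e s i) (deg-remove simple₂ g₂bw i) ⟩
    deg g₃ i + e b i + e w i + e s i                    ≡⟨ rearrange′ (deg g₃ i) (e b i) (e w i) (e s i) ⟩
    deg g₃ i + e w i + e s i + e b i                    ∎) ⟩
  deg g₃ i + e w i + e s i                            ∎
  where
  open ≡-Reasoning
  g₁ g₂ g₃ : Adj n
  g₁ = toggle s u g
  g₂ = toggle u b g₁
  g₃ = toggle b w g₂
  simple₁ : Simple g₁
  simple₁ = toggle-simple s u simple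
  simple₂ : Simple g₂
  simple₂ = toggle-simple u b simple₁
  g₁ub : g₁ u b ≡ false
  g₁ub = trans (toggle-miss g (value-misses simple (true≢false gsu gub))) gub
  g₂bw : g₂ b w ≡ true
  g₂bw = trans (toggles-miss ((s , u) ∷ (u , b) ∷ []) g
    (first-misses s≢b u≢b ∷ value-misses simple (false≢true gub gbw) ∷ [])) gbw
  rearrange : ∀ d s u b → d + s + u + b ≡ d + u + b + s
  rearrange = solve-∀
  rearrange′ : ∀ d b w s → d + b + w + s ≡ d + w + s + b
  rearrange′ = solve-∀

-- Alternating trails from w₁ to w₂ of length 1, 3 or 5 that start and end with a
-- non-edge, padded with loops.
data Middle (g : Adj n) (w₁ w₂ : Fin n) : (z₁ z₂ z₃ z₄ : Fin n) → Set where
  one   : w₁ ≢ w₂ → g w₁ w₂ ≡ false → Middle g w₁ w₂ w₁ w₁ w₁ w₁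
  -- Here `w₁` and `w₂` may coincide: the two non-edges differ already because `z₂` is neither `w₁`
  -- nor `z₁`.
  three : ∀ {z₁ z₂} → w₁ ≢ z₁ → w₁ ≢ z₂ → w₂ ≢ z₂ →
    g w₁ z₁ ≡ false → g z₁ z₂ ≡ true → g w₂ z₂ ≡ false → Middle g w₁ w₂ z₁ z₂ z₂ z₂
  five  : ∀ {z₁ z₂ z₃ z₄} → (∀ {w} → w ≡ w₁ ⊎ w ≡ w₂ → (w ≢ z₁ × w ≢ z₂) × (w ≢ z₃ × w ≢ z₄)) →
    z₁ ≢ z₃ → z₁ ≢ z₄ → z₂ ≢ z₃ → z₂ ≢ z₄ →
    g w₁ z₁ ≡ false → g z₁ z₂ ≡ true → g z₂ z₃ ≡ false → g z₃ z₄ ≡ true → g w₂ z₄ ≡ false →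
    Middle g w₁ w₂ z₁ z₂ z₃ z₄

middle-degree : ∀ {g : Adj n} {w₁ w₂ z₁ z₂ z₃ z₄} → Simple g → Middle g w₁ w₂ z₁ z₂ z₃ z₄ →
  ∀ i → deg (toggles (middle-path w₁ z₁ z₂ z₃ z₄ w₂) g) i ≡ deg g i + e w₁ i + e w₂ i
middle-degree {g = g} {w₁} {w₂} simple (one w₁≢w₂ gww) i =
  trans (deg-add (toggles-simple loops simple) w₁≢w₂
          (trans (toggles-miss loops g (loop-misses ∷ loop-misses ∷ loop-misses ∷ loop-misses ∷ [])) gww) i)
        (cong (λ d → d + e w₁ i + e w₂ i) (deg-cong {g = toggles loops g} {g} (λ i j → toggles-miss loops g
          (loop-misses ∷ loop-misses ∷ loop-misses ∷ loop-misses ∷ [])) i))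
  where loops = (w₁ , w₁) ∷ (w₁ , w₁) ∷ (w₁ , w₁) ∷ (w₁ , w₁) ∷ []
middle-degree {n} {g} {w₁} {w₂} {z₁} {z₂} simple (three w₁≢z₁ w₁≢z₂ w₂≢z₂ gwz gzz gzw) i = begin
  deg (toggle z₂ w₂ g₄) i                            ≡⟨ deg-add (toggles-simple ((z₂ , z₂) ∷ (z₂ , z₂) ∷ []) simple₂) (w₂≢z₂ ∘ sym) g₄zw i ⟩
  deg g₄ i + e z₂ i + e w₂ i                         ≡⟨ cong (λ d → d + e z₂ i + e w₂ i) (trans (deg-loop z₂ g₃ i) (deg-loop z₂ g₂ i)) ⟩
  deg g₂ i + e z₂ i + e w₂ i                         ≡⟨ +-cancelʳ-≡ (e z₁ i) _ _ (begin
    deg g₂ i + e z₂ i + e w₂ i + e z₁ i                ≡⟨ rearrange (deg g₂ i) (e z₂ i) (e w₂ i) (e z₁ i) ⟩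
    deg g₂ i + e z₁ i + e z₂ i + e w₂ i                ≡⟨ cong (_+ e w₂ i) (deg-remove simple₁ g₁zz i) ⟨
    deg g₁ i + e w₂ i                                  ≡⟨ cong (_+ e w₂ i) (deg-add simple w₁≢z₁ gwz i) ⟩
    deg g i + e w₁ i + e z₁ i + e w₂ i                 ≡⟨ swap (deg g i + e w₁ i) (e z₁ i) (e w₂ i) ⟩
    deg g i + e w₁ i + e w₂ i + e z₁ i                 ∎) ⟩
  deg g i + e w₁ i + e w₂ i                          ∎
  where
  open ≡-Reasoning
  g₁ g₂ g₃ g₄ : Adj n
  g₁ = toggle w₁ z₁ g
  g₂ = toggle z₁ z₂ g₁
  g₃ = toggle z₂ z₂ g₂
  g₄ = toggle z₂ z₂ g₃
  simple₁ : Simple g₁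
  simple₁ = toggle-simple w₁ z₁ simple
  simple₂ : Simple g₂
  simple₂ = toggle-simple z₁ z₂ simple₁
  g₁zz : g₁ z₁ z₂ ≡ true
  g₁zz = trans (toggle-miss g (value-misses simple (false≢true gwz gzz))) gzz
  gz₂w₂ : g z₂ w₂ ≡ false
  gz₂w₂ = trans (Simple.symm simple _ _) gzw
  g₄zw : g₄ z₂ w₂ ≡ false
  g₄zw = trans (toggles-miss ((w₁ , z₁) ∷ (z₁ , z₂) ∷ (z₂ , z₂) ∷ (z₂ , z₂) ∷ []) g
    (first-misses w₁≢z₂ (adjacent⇒≢ simple gzz) ∷ value-misses simple (true≢false gzz gz₂w₂) ∷ loop-misses ∷ loop-misses ∷ []))
    gz₂w₂
  rearrange : ∀ d x y z → d + x + y + z ≡ d + z + x + y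
  rearrange = solve-∀
  swap : ∀ x y z → x + y + z ≡ x + z + y
  swap = solve-∀
middle-degree {n} {g} {w₁} {w₂} {z₁} {z₂} {z₃} {z₄} simple (five w≢z z₁≢z₃ z₁≢z₄ z₂≢z₃ z₂≢z₄ gwz gzz gzz′ gzz″ gzw) i =
  +-cancelʳ-≡ (e z₁ i + e z₂ i + e z₃ i + e z₄ i) _ _ (begin
    deg g₅ i + (e z₁ i + e z₂ i + e z₃ i + e z₄ i)                    ≡⟨ cong (_+ (e z₁ i + e z₂ i + e z₃ i + e z₄ i)) (deg-add simple₄ (w≢z₄ ∘ sym) g₄zw i) ⟩
    deg g₄ i + e z₄ i + e w₂ i + (e z₁ i + e z₂ i + e z₃ i + e z₄ i)  ≡⟨ rearrange₄ (deg g₄ i) (e z₁ i) (e z₂ i) (e z₃ i) (e z₄ i) (e w₂ i) ⟩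
    deg g₄ i + e z₃ i + e z₄ i + (e z₁ i + e z₂ i + e z₄ i + e w₂ i)  ≡⟨ cong (_+ (e z₁ i + e z₂ i + e z₄ i + e w₂ i)) (deg-remove simple₃ g₃zz i) ⟨
    deg g₃ i + (e z₁ i + e z₂ i + e z₄ i + e w₂ i)                    ≡⟨ cong (_+ (e z₁ i + e z₂ i + e z₄ i + e w₂ i)) (deg-add simple₂ z₂≢z₃ g₂zz i) ⟩
    deg g₂ i + e z₂ i + e z₃ i + (e z₁ i + e z₂ i + e z₄ i + e w₂ i)  ≡⟨ rearrange₂ (deg g₂ i) (e z₁ i) (e z₂ i) (e z₃ i) (e z₄ i) (e w₂ i) ⟩
    deg g₂ i + e z₁ i + e z₂ i + (e z₂ i + e z₃ i + e z₄ i + e w₂ i)  ≡⟨ cong (_+ (e z₂ i + e z₃ i + e z₄ i + e w₂ i)) (deg-remove simple₁ g₁zz i) ⟨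
    deg g₁ i + (e z₂ i + e z₃ i + e z₄ i + e w₂ i)                    ≡⟨ cong (_+ (e z₂ i + e z₃ i + e z₄ i + e w₂ i)) (deg-add simple w≢z₁ gwz i) ⟩
    deg g i + e w₁ i + e z₁ i + (e z₂ i + e z₃ i + e z₄ i + e w₂ i)   ≡⟨ rearrange₀ (deg g i) (e w₁ i) (e z₁ i) (e z₂ i) (e z₃ i) (e z₄ i) (e w₂ i) ⟩
    deg g i + e w₁ i + e w₂ i + (e z₁ i + e z₂ i + e z₃ i + e z₄ i)   ∎)
  where
  open ≡-Reasoning
  w≢z₁ = proj₁ (proj₁ (w≢z (inj₁ refl)))
  w≢z₄ = proj₂ (proj₂ (w≢z (inj₂ refl)))
  g₁ g₂ g₃ g₄ g₅ : Adj n
  g₁ = toggle w₁ z₁ g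
  g₂ = toggle z₁ z₂ g₁
  g₃ = toggle z₂ z₃ g₂
  g₄ = toggle z₃ z₄ g₃
  g₅ = toggle z₄ w₂ g₄
  simple₁ : Simple g₁
  simple₁ = toggle-simple w₁ z₁ simple
  simple₂ : Simple g₂
  simple₂ = toggle-simple z₁ z₂ simple₁
  simple₃ : Simple g₃
  simple₃ = toggle-simple z₂ z₃ simple₂
  simple₄ : Simple g₄
  simple₄ = toggle-simple z₃ z₄ simple₃
  gz₄w₂ : g z₄ w₂ ≡ false
  gz₄w₂ = trans (Simple.symm simple _ _) gzw
  g₁zz : g₁ z₁ z₂ ≡ true
  g₁zz = trans (toggle-miss g (value-misses simple (false≢true gwz gzz))) gzz
  g₂zz : g₂ z₂ z₃ ≡ false
  g₂zz = trans (toggles-miss ((w₁ , z₁) ∷ (z₁ , z₂) ∷ []) g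
    (left-misses (proj₂ (proj₁ (w≢z (inj₁ refl)))) (proj₁ (proj₂ (w≢z (inj₁ refl)))) ∷ value-misses simple (true≢false gzz gzz′) ∷ [])) gzz′
  g₃zz : g₃ z₃ z₄ ≡ true
  g₃zz = trans (toggles-miss ((w₁ , z₁) ∷ (z₁ , z₂) ∷ (z₂ , z₃) ∷ []) g
    (value-misses simple (false≢true gwz gzz″) ∷ left-misses z₁≢z₃ z₁≢z₄ ∷ value-misses simple (false≢true gzz′ gzz″) ∷ [])) gzz″
  g₄zw : g₄ z₄ w₂ ≡ false
  g₄zw = trans (toggles-miss ((w₁ , z₁) ∷ (z₁ , z₂) ∷ (z₂ , z₃) ∷ (z₃ , z₄) ∷ []) g
    (first-misses (proj₂ (proj₂ (w≢z (inj₁ refl)))) z₁≢z₄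
    ∷ value-misses simple (true≢false gzz gz₄w₂)
    ∷ second-misses (proj₂ (proj₁ (w≢z (inj₂ refl))) ∘ sym) (proj₁ (proj₂ (w≢z (inj₂ refl))) ∘ sym)
    ∷ value-misses simple (true≢false gzz″ gz₄w₂) ∷ [])) gz₄w₂
  rearrange₀ : ∀ d a z₁ z₂ z₃ z₄ w → d + a + z₁ + (z₂ + z₃ + z₄ + w) ≡ d + a + w + (z₁ + z₂ + z₃ + z₄)
  rearrange₀ = solve-∀
  rearrange₂ : ∀ d z₁ z₂ z₃ z₄ w → d + z₂ + z₃ + (z₁ + z₂ + z₄ + w) ≡ d + z₁ + z₂ + (z₂ + z₃ + z₄ + w)
  rearrange₂ = solve-∀
  rearrange₄ : ∀ d z₁ z₂ z₃ z₄ w → d + z₄ + w + (z₁ + z₂ + z₃ + z₄) ≡ d + z₃ + z₄ + (z₁ + z₂ + z₄ + w)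
  rearrange₄ = solve-∀

-- Graphs without short alternating trails

trail : (p q u₁ b₁ w₁ z₁ z₂ z₃ z₄ w₂ b₂ u₂ : Fin n) → List (Fin n × Fin n)
trail p q u₁ b₁ w₁ z₁ z₂ z₃ z₄ w₂ b₂ u₂ =
  root-path p u₁ b₁ w₁ ++ root-path q u₂ b₂ w₂ ++ middle-path w₁ z₁ z₂ z₃ z₄ w₂

two-positive : (f : Vector ℕ n) → (∀ i → f i ≤ 1) → 2 ≤ sumℕ f → ∃ λ i → ∃ λ j → i ≢ j × 0 < f i × 0 < f j
two-positive f f≤1 2≤Σ with any? (λ i → any? λ j → ¬? (i ≟ j) ×-dec (0 <? f i) ×-dec (0 <? f j))
... | yes pair = pair
... | no none  = contradiction (≤-trans 2≤Σ (sum-unit f≤1 unique)) λ { (s≤s ()) }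
  where
  unique : ∀ i j → 0 < f i → 0 < f j → i ≡ j
  unique i j 0<fi 0<fj with i ≟ j
  ... | yes i≡j = i≡j
  ... | no i≢j  = contradiction (i , j , i≢j , 0<fi , 0<fj) none

-- Below, A stands for the common neighbourhood of p and q.
module Stuck {h : Adj n} {D : Vector ℕ n} {p q : Fin n} (simple : Simple h)
  (degrees : ∀ i → deg h i ≡ D i + e p i + e q i)
  (twins : ∀ j → h p j ≡ h q j)
  (stuck : ∀ u₁ b₁ w₁ z₁ z₂ z₃ z₄ w₂ b₂ u₂ → ¬ (∀ i → deg (toggles (trail p q u₁ b₁ w₁ z₁ z₂ z₃ z₄ w₂ b₂ u₂) h) i ≡ D i))
  where

  open Simple simple

  p∉A : h p p ≡ false
  p∉A = irr p

  q∉A : h p q ≡ false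
  q∉A = trans (twins q) (irr q)

  differ : ∀ {u v} → h p u ≡ true → h p v ≡ false → u ≢ v
  differ pu pv refl with () ← trans (sym pu) pv

  -- Two root trails, from p to w₁ and from q to w₂, that can be toggled together:
  -- in the resulting graph K the surplus at p and q has become a deficit at w₁ and
  -- w₂, and a middle trail from w₁ to w₂ in K completes a trail from p to q.
  record Rooted (w₁ w₂ : Fin n) : Set where
    field
      {u₁ b₁ u₂ b₂} : Fin n
    K₁ : Adj n
    K₁ = toggles (root-path p u₁ b₁ w₁) h
    K : Adj n
    K = toggles (root-path q u₂ b₂ w₂) K₁
    field
      root₁ : Root h p w₁ u₁ b₁
      root₂ : Root K₁ q w₂ u₂ b₂
      -- These three fields let a middle trail be sought in `h`: non-edges at its two ends survive
      -- the toggling of the roots, and pairs outside `A` that avoid both ends are untouched.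
      near₁ : ∀ j → h w₁ j ≡ false → K w₁ j ≡ false
      near₂ : ∀ j → h w₂ j ≡ false → K w₂ j ≡ false
      far   : ∀ i j → h p i ≡ false → h p j ≡ false →
              w₁ ≢ i → w₁ ≢ j → w₂ ≢ i → w₂ ≢ j → K i j ≡ h i j

  no-middle : ∀ {w₁ w₂ z₁ z₂ z₃ z₄} (r : Rooted w₁ w₂) → ¬ Middle (Rooted.K r) w₁ w₂ z₁ z₂ z₃ z₄
  no-middle {w₁} {w₂} {z₁} {z₂} {z₃} {z₄} r middle = stuck u₁ b₁ w₁ z₁ z₂ z₃ z₄ w₂ b₂ u₂ λ i → begin
    deg (toggles (middle-path w₁ z₁ z₂ z₃ z₄ w₂) K) i   ≡⟨ middle-degree (toggles-simple (root-path q u₂ b₂ w₂) simple₁) middle i ⟩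
    deg K i + e w₁ i + e w₂ i                           ≡⟨ +-cancelʳ-≡ (e p i + e q i) _ _ (balance i) ⟩
    D i                                                 ∎
    where
    open Rooted r
    open ≡-Reasoning
    simple₁ : Simple K₁
    simple₁ = toggles-simple (root-path p u₁ b₁ w₁) simple
    balance : ∀ i → deg K i + e w₁ i + e w₂ i + (e p i + e q i) ≡ D i + (e p i + e q i)
    balance i = begin
      deg K i + e w₁ i + e w₂ i + (e p i + e q i)       ≡⟨ rearrange (deg K i) (e w₁ i) (e w₂ i) (e p i) (e q i) ⟩
      deg K i + e w₂ i + e q i + e w₁ i + e p i         ≡⟨ cong (λ d → d + e w₁ i + e p i) (root-degree simple₁ root₂ i) ⟨
      deg K₁ i + e w₁ i + e p i                         ≡⟨ root-degree simple root₁ i ⟨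
      deg h i                                           ≡⟨ degrees i ⟩
      D i + e p i + e q i                               ≡⟨ +-assoc (D i) (e p i) (e q i) ⟩
      D i + (e p i + e q i)                             ∎
      where
      rearrange : ∀ d x y a b → d + x + y + (a + b) ≡ d + y + b + x + a
      rearrange = solve-∀

  -- The data of a root trail `p`, `u`, `b`, `w`; as `p` and `q` are twins, it serves equally as a
  -- trail from `q`.
  record Port (u b w : Fin n) : Set where
    constructor port
    field
      u∈A : h p u ≡ true
      u≁b : h u b ≡ false
      b∉A : h p b ≡ false
      b~w : h b w ≡ true

    p≢b : p ≢ b
    p≢b refl = true≢false (trans (symm u p) u∈A) u≁b refl

    q≢b : q ≢ b
    q≢b refl = true≢false (trans (symm u q) (trans (sym (twins u)) u∈A)) u≁b refl

    q~u : h q u ≡ true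
    q~u = trans (sym (twins u)) u∈A

    u≢b : u ≢ b
    u≢b = differ u∈A b∉A

    u≢w : u ≢ w
    u≢w refl = true≢false b~w (trans (symm b u) u≁b) refl

    b≢w : b ≢ w
    b≢w = adjacent⇒≢ simple b~w

  rooted-direct : ∀ {w₁ w₂} → h p w₁ ≡ true → h p w₂ ≡ true → w₁ ≢ w₂ ⊎ p ≢ q → Rooted w₁ w₂
  rooted-direct {w₁} {w₂} pw₁ pw₂ distinct = record
    { root₁ = direct pw₁
    ; root₂ = direct (trans (toggles-miss ((p , p) ∷ (p , p) ∷ (p , w₁) ∷ []) h (loop-misses ∷ loop-misses ∷ apart distinct ∷ [])) qw₂)
    ; near₁ = λ j w₁≁j → trans (misses λ u v uv → value-misses simple (true≢false uv w₁≁j)) w₁≁j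
    ; near₂ = λ j w₂≁j → trans (misses λ u v uv → value-misses simple (true≢false uv w₂≁j)) w₂≁j
    ; far   = λ i j _ _ w₁≢i w₁≢j w₂≢i w₂≢j → toggles-miss path h
        (loop-misses ∷ loop-misses ∷ right-misses w₁≢i w₁≢j ∷ loop-misses ∷ loop-misses ∷ right-misses w₂≢i w₂≢j ∷ [])
    }
    where
    path = root-path p p p w₁ ++ root-path q q q w₂
    qw₂ : h q w₂ ≡ true
    qw₂ = trans (sym (twins w₂)) pw₂
    apart : w₁ ≢ w₂ ⊎ p ≢ q → ¬ Hits p w₁ q w₂
    apart (inj₁ w₁≢w₂) = right-misses (differ pw₁ q∉A) w₁≢w₂
    apart (inj₂ p≢q)   = left-misses p≢q (differ pw₂ p∉A ∘ sym)
    misses : ∀ {i j} → (∀ u v → h u v ≡ true → ¬ Hits u v i j) → toggles path h i j ≡ h i j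
    misses miss = toggles-miss path h
      (loop-misses ∷ loop-misses ∷ miss p w₁ pw₁ ∷ loop-misses ∷ loop-misses ∷ miss q w₂ qw₂ ∷ [])

  rooted-direct-via : ∀ {w₁ w₂ u₂ b₂} → h p w₁ ≡ true → Port u₂ b₂ w₂ → u₂ ≢ w₁ → Rooted w₁ w₂
  rooted-direct-via {w₁} {w₂} {u₂} {b₂} pw₁ port₂ u₂≢w₁ = record
    { root₁ = direct pw₁
    ; root₂ = via (trans (toggles-miss first h (loop-misses ∷ loop-misses ∷ right-misses (differ pw₁ q∉A) (u₂≢w₁ ∘ sym) ∷ [])) q~u)
                  (trans (toggles-miss first h (loop-misses ∷ loop-misses ∷ value-misses simple (true≢false pw₁ u≁b) ∷ [])) u≁b)
                  (trans (toggles-miss first h (loop-misses ∷ loop-misses ∷ first-misses p≢b (differ pw₁ b∉A) ∷ [])) b~w)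
                  q≢b u≢b
    ; near₁ = λ j w₁≁j → trans (misses (λ u v uv → value-misses simple (true≢false uv w₁≁j))
        (first-misses u₂≢w₁ (differ pw₁ b∉A ∘ sym))) w₁≁j
    ; near₂ = λ j w₂≁j → trans (misses (λ u v uv → value-misses simple (true≢false uv w₂≁j))
        (first-misses u≢w b≢w)) w₂≁j
    ; far   = λ i j pi pj w₁≢i w₁≢j w₂≢i w₂≢j → toggles-miss path h
        (loop-misses ∷ loop-misses ∷ right-misses w₁≢i w₁≢j
        ∷ right-misses (differ u∈A pi) (differ u∈A pj) ∷ left-misses (differ u∈A pi) (differ u∈A pj) ∷ right-misses w₂≢i w₂≢j ∷ [])
    }
    where
    open Port port₂
    first = root-path p p p w₁
    path = first ++ root-path q u₂ b₂ w₂
    misses : ∀ {i j} → (∀ u v → h u v ≡ true → ¬ Hits u v i j) → ¬ Hits u₂ b₂ i j → toggles path h i j ≡ h i j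
    misses miss miss₂ = toggles-miss path h
      (loop-misses ∷ loop-misses ∷ miss p w₁ pw₁ ∷ miss q u₂ q~u ∷ miss₂ ∷ miss b₂ w₂ b~w ∷ [])

  rooted-via-direct : ∀ {w₁ w₂ u₁ b₁} → Port u₁ b₁ w₁ → h p w₂ ≡ true → u₁ ≢ w₂ → Rooted w₁ w₂
  rooted-via-direct {w₁} {w₂} {u₁} {b₁} port₁ pw₂ u₁≢w₂ = record
    { root₁ = via u∈A u≁b b~w p≢b u≢b
    ; root₂ = direct (trans (toggles-miss first h (right-misses (differ u∈A q∉A) u₁≢w₂
        ∷ value-misses simple (false≢true u≁b qw₂) ∷ left-misses (q≢b ∘ sym) (differ pw₂ b∉A ∘ sym) ∷ [])) qw₂)
    ; near₁ = λ j w₁≁j → trans (misses (λ u v uv → value-misses simple (true≢false uv w₁≁j))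
        (first-misses u≢w b≢w)) w₁≁j
    ; near₂ = λ j w₂≁j → trans (misses (λ u v uv → value-misses simple (true≢false uv w₂≁j))
        (first-misses u₁≢w₂ (differ pw₂ b∉A ∘ sym))) w₂≁j
    ; far   = λ i j pi pj w₁≢i w₁≢j w₂≢i w₂≢j → toggles-miss path h
        (right-misses (differ u∈A pi) (differ u∈A pj) ∷ left-misses (differ u∈A pi) (differ u∈A pj) ∷ right-misses w₁≢i w₁≢j
        ∷ loop-misses ∷ loop-misses ∷ right-misses w₂≢i w₂≢j ∷ [])
    }
    where
    open Port port₁
    first = root-path p u₁ b₁ w₁
    path = first ++ root-path q q q w₂
    qw₂ : h q w₂ ≡ true
    qw₂ = trans (sym (twins w₂)) pw₂
    misses : ∀ {i j} → (∀ u v → h u v ≡ true → ¬ Hits u v i j) → ¬ Hits u₁ b₁ i j → toggles path h i j ≡ h i j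
    misses miss miss₁ = toggles-miss path h
      (miss p u₁ u∈A ∷ miss₁ ∷ miss b₁ w₁ b~w ∷ loop-misses ∷ loop-misses ∷ miss q w₂ qw₂ ∷ [])

  -- `u₁ ≢ u₂` separates the first edges, even if `p` equals `q`, and also the non-edges. The
  -- alternative `b₁ ≢ b₂ ⊎ w₁ ≢ w₂` separates the last edges.
  rooted-via : ∀ {w₁ w₂ u₁ b₁ u₂ b₂} → Port u₁ b₁ w₁ → Port u₂ b₂ w₂ → u₁ ≢ u₂ → b₁ ≢ b₂ ⊎ w₁ ≢ w₂ →
    h p w₁ ≡ false → h p w₂ ≡ false → b₁ ≢ w₂ → b₂ ≢ w₁ → Rooted w₁ w₂
  rooted-via {w₁} {w₂} {u₁} {b₁} {u₂} {b₂} port₁ port₂ u₁≢u₂ distinct pw₁ pw₂ b₁≢w₂ b₂≢w₁ = record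
    { root₁ = via P.u∈A P.u≁b P.b~w P.p≢b P.u≢b
    ; root₂ = via
        (trans (toggles-miss first h (right-misses (differ P.u∈A q∉A) u₁≢u₂
          ∷ value-misses simple (false≢true P.u≁b Q.q~u) ∷ left-misses (P.q≢b ∘ sym) (differ Q.u∈A P.b∉A ∘ sym) ∷ [])) Q.q~u)
        (trans (toggles-miss first h (value-misses simple (true≢false P.u∈A Q.u≁b)
          ∷ left-misses u₁≢u₂ (differ P.u∈A Q.b∉A) ∷ value-misses simple (true≢false P.b~w Q.u≁b) ∷ [])) Q.u≁b)
        (trans (toggles-miss first h (first-misses Q.p≢b (differ P.u∈A Q.b∉A)
          ∷ value-misses simple (false≢true P.u≁b Q.b~w) ∷ apart distinct ∷ [])) Q.b~w)
        Q.q≢b Q.u≢b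
    ; near₁ = λ j w₁≁j → trans (misses (λ u v uv → value-misses simple (true≢false uv w₁≁j))
        (first-misses P.u≢w P.b≢w) (first-misses (differ Q.u∈A pw₁) b₂≢w₁)) w₁≁j
    ; near₂ = λ j w₂≁j → trans (misses (λ u v uv → value-misses simple (true≢false uv w₂≁j))
        (first-misses (differ P.u∈A pw₂) b₁≢w₂) (first-misses Q.u≢w Q.b≢w)) w₂≁j
    ; far   = λ i j pi pj w₁≢i w₁≢j w₂≢i w₂≢j → toggles-miss path h
        (right-misses (differ P.u∈A pi) (differ P.u∈A pj) ∷ left-misses (differ P.u∈A pi) (differ P.u∈A pj) ∷ right-misses w₁≢i w₁≢j
        ∷ right-misses (differ Q.u∈A pi) (differ Q.u∈A pj) ∷ left-misses (differ Q.u∈A pi) (differ Q.u∈A pj) ∷ right-misses w₂≢i w₂≢j ∷ [])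
    }
    where
    module P = Port port₁
    module Q = Port port₂
    first = root-path p u₁ b₁ w₁
    path = first ++ root-path q u₂ b₂ w₂
    apart : b₁ ≢ b₂ ⊎ w₁ ≢ w₂ → ¬ Hits b₁ w₁ b₂ w₂
    apart (inj₁ b₁≢b₂) = left-misses b₁≢b₂ b₁≢w₂
    apart (inj₂ w₁≢w₂) = right-misses (b₂≢w₁ ∘ sym) w₁≢w₂
    misses : ∀ {i j} → (∀ u v → h u v ≡ true → ¬ Hits u v i j) → ¬ Hits u₁ b₁ i j → ¬ Hits u₂ b₂ i j → toggles path h i j ≡ h i j
    misses miss miss₁ miss₂ = toggles-miss path h
      (miss p u₁ P.u∈A ∷ miss₁ ∷ miss b₁ w₁ P.b~w ∷ miss q u₂ Q.q~u ∷ miss₂ ∷ miss b₂ w₂ Q.b~w ∷ [])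

  adjacent : ∀ {u v} → ¬ (h u v ≡ false) → h u v ≡ true
  adjacent {u} {v} u≁v→⊥ with h u v
  ... | true  = refl
  ... | false = contradiction refl u≁v→⊥

  nonadjacent : ∀ {u v} → ¬ (h u v ≡ true) → h u v ≡ false
  nonadjacent {u} {v} u~v→⊥ with h u v
  ... | true  = contradiction refl u~v→⊥
  ... | false = refl

  -- A non-edge between the ends would itself be a middle trail of length 1.
  rooted⇒adjacent : ∀ {w₁ w₂} → Rooted w₁ w₂ → w₁ ≢ w₂ → h w₁ w₂ ≡ true
  rooted⇒adjacent r w₁≢w₂ = adjacent λ w₁≁w₂ → no-middle r (one w₁≢w₂ (Rooted.near₁ r _ w₁≁w₂))

  A-clique : ∀ {u v} → h p u ≡ true → h p v ≡ true → u ≢ v → h u v ≡ true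
  A-clique pu pv u≢v = rooted⇒adjacent (rooted-direct pu pv (inj₁ u≢v)) u≢v

  -- An edge `z₁ z₂` would complete the middle trail `w₁`, `z₁`, `z₂`, `w₂`.
  rooted⇒independent : ∀ {w₁ w₂ z₁ z₂} → Rooted w₁ w₂ → h p z₁ ≡ false → h p z₂ ≡ false →
    w₁ ≢ z₁ → w₁ ≢ z₂ → w₂ ≢ z₁ → w₂ ≢ z₂ → h w₁ z₁ ≡ false → h w₂ z₂ ≡ false → h z₁ z₂ ≡ false
  rooted⇒independent r pz₁ pz₂ w₁≢z₁ w₁≢z₂ w₂≢z₁ w₂≢z₂ w₁≁z₁ w₂≁z₂ = nonadjacent λ z₁~z₂ →
    no-middle r (three w₁≢z₁ w₁≢z₂ w₂≢z₂ (Rooted.near₁ r _ w₁≁z₁)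
      (trans (Rooted.far r _ _ pz₁ pz₂ w₁≢z₁ w₁≢z₂ w₂≢z₁ w₂≢z₂) z₁~z₂) (Rooted.near₂ r _ w₂≁z₂))

  -- The vertices reached by short trails

  NonNbr : Fin n → Fin n → Set
  NonNbr u b = h p u ≡ true × h u b ≡ false × u ≢ b

  nonNbr? : ∀ u b → Dec (NonNbr u b)
  nonNbr? u b = (h p u Bool.≟ true) ×-dec (h u b Bool.≟ false) ×-dec ¬? (u ≟ b)

  nonNbr∉A : ∀ {u b} → NonNbr u b → h p b ≡ false
  nonNbr∉A (pu , u≁b , u≢b) = nonadjacent λ pb → true≢false (A-clique pu pb u≢b) u≁b refl

  toPort : ∀ {u b w} → NonNbr u b → h b w ≡ true → Port u b w
  toPort u≁b@(pu , ub , _) b~w = port pu ub (nonNbr∉A u≁b) b~w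

  nonNbrs-independent : ∀ {u v b c} → NonNbr u b → NonNbr v c → u ≢ v ⊎ p ≢ q → h b c ≡ false
  nonNbrs-independent u≁b@(pu , ub , u≢b) v≁c@(pv , vc , v≢c) distinct =
    rooted⇒independent (rooted-direct pu pv distinct) b∉A c∉A (differ pu b∉A) (differ pu c∉A) (differ pv b∉A) (differ pv c∉A) ub vc
    where
    b∉A = nonNbr∉A u≁b
    c∉A = nonNbr∉A v≁c

  -- Requiring two different u for membership in A′ and in B₂ leaves room to choose
  -- root trails for two vertices that do not share a pair.
  InA′ InU InB₂ InB InB⁺ Double : Fin n → Set
  InA′ w = h p w ≡ false × ∃ λ u₁ → ∃ λ b₁ → ∃ λ u₂ → ∃ λ b₂ →
    u₁ ≢ u₂ × (NonNbr u₁ b₁ × h b₁ w ≡ true) × (NonNbr u₂ b₂ × h b₂ w ≡ true)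
  InU w = h p w ≡ true ⊎ InA′ w
  InB₂ b = ∃ λ u₁ → ∃ λ u₂ → u₁ ≢ u₂ × NonNbr u₁ b × NonNbr u₂ b
  InB b = b ≡ p ⊎ b ≡ q ⊎ InB₂ b
  InB⁺ b = b ≡ p ⊎ b ≡ q ⊎ ∃ λ u → NonNbr u b
  Double w = ∃ λ b → ∃ λ c → b ≢ c × (InB⁺ b × h b w ≡ true) × (InB⁺ c × h c w ≡ true)

  abstract
    inU? : ∀ w → Dec (InU w)
    inU? w = (h p w Bool.≟ true) ⊎-dec (h p w Bool.≟ false) ×-dec any? λ u₁ → any? λ b₁ → any? λ u₂ → any? λ b₂ →
      ¬? (u₁ ≟ u₂) ×-dec (nonNbr? u₁ b₁ ×-dec (h b₁ w Bool.≟ true)) ×-dec (nonNbr? u₂ b₂ ×-dec (h b₂ w Bool.≟ true))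

    inB? : ∀ b → Dec (InB b)
    inB? b = (b ≟ p) ⊎-dec (b ≟ q) ⊎-dec any? λ u₁ → any? λ u₂ → ¬? (u₁ ≟ u₂) ×-dec nonNbr? u₁ b ×-dec nonNbr? u₂ b

    inB⁺? : ∀ b → Dec (InB⁺ b)
    inB⁺? b = (b ≟ p) ⊎-dec (b ≟ q) ⊎-dec any? λ u → nonNbr? u b

    double? : ∀ w → Dec (Double w)
    double? w = any? λ b → any? λ c →
      ¬? (b ≟ c) ×-dec (inB⁺? b ×-dec (h b w Bool.≟ true)) ×-dec (inB⁺? c ×-dec (h c w Bool.≟ true))

  B⊆B⁺ : ∀ {b} → InB b → InB⁺ b
  B⊆B⁺ (inj₁ b≡p)                               = inj₁ b≡p
  B⊆B⁺ (inj₂ (inj₁ b≡q))                        = inj₂ (inj₁ b≡q)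
  B⊆B⁺ (inj₂ (inj₂ (u , _ , _ , u≁b , _)))      = inj₂ (inj₂ (u , u≁b))

  avoiding-port : ∀ {w} → InA′ w → ∀ x → ∃ λ u → ∃ λ b → u ≢ x × NonNbr u b × Port u b w
  avoiding-port (_ , u₁ , b₁ , u₂ , b₂ , u₁≢u₂ , (n₁ , b₁~w) , (n₂ , b₂~w)) x with u₁ ≟ x
  ... | no u₁≢x  = u₁ , b₁ , u₁≢x , n₁ , toPort n₁ b₁~w
  ... | yes refl = u₂ , b₂ , u₁≢u₂ ∘ sym , n₂ , toPort n₂ b₂~w

  -- For `w` in `A` this is the clique property. For `w` in `A′`, a port through some `v ≢ u` has a
  -- base adjacent to `w`, whereas non-neighbours of the different vertices `v` and `u` are never
  -- adjacent.
  U-no-nonNbr : ∀ {w u} → InU w → ¬ NonNbr u w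
  U-no-nonNbr (inj₁ pw) u≁w = true≢false pw (nonNbr∉A u≁w) refl
  U-no-nonNbr {u = u} (inj₂ w∈A′) u≁w with avoiding-port w∈A′ u
  ... | v , b , v≢u , v≁b , pt = true≢false (Port.b~w pt) (nonNbrs-independent v≁b u≁w (inj₁ v≢u)) refl

  p∉U : ¬ InU p
  p∉U (inj₁ pp) = true≢false pp p∉A refl
  p∉U (inj₂ p∈A′) with avoiding-port p∈A′ p
  ... | _ , b , _ , _ , pt = true≢false (trans (symm p b) (Port.b~w pt)) (Port.b∉A pt) refl

  q∉U : ¬ InU q
  q∉U (inj₁ pq) = true≢false pq q∉A refl
  q∉U (inj₂ q∈A′) with avoiding-port q∈A′ q
  ... | _ , b , _ , _ , pt = true≢false (trans (twins b) (trans (symm q b) (Port.b~w pt))) (Port.b∉A pt) refl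

  B⁺∩U : ∀ {b} → InB⁺ b → ¬ InU b
  B⁺∩U (inj₁ refl)              = p∉U
  B⁺∩U (inj₂ (inj₁ refl))       = q∉U
  B⁺∩U (inj₂ (inj₂ (u , u≁b))) b∈U = U-no-nonNbr b∈U u≁b

  port-base∉U : ∀ {u b w v} → Port u b w → InU v → b ≢ v
  port-base∉U pt v∈U refl = U-no-nonNbr v∈U (Port.u∈A pt , Port.u≁b pt , Port.u≢b pt)

  -- The two routes to a vertex of `A′` leave a port that avoids the one vertex of the other trail
  -- with which it could clash: its end if that trail is direct, otherwise its first inner vertex.
  U-rooted : ∀ {w₁ w₂} → InU w₁ → InU w₂ → w₁ ≢ w₂ → Rooted w₁ w₂
  U-rooted (inj₁ pw₁) (inj₁ pw₂) w₁≢w₂ = rooted-direct pw₁ pw₂ (inj₁ w₁≢w₂)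
  U-rooted {w₁} (inj₁ pw₁) (inj₂ w₂∈A′) w₁≢w₂ with avoiding-port w₂∈A′ w₁
  ... | _ , _ , u≢w₁ , _ , pt = rooted-direct-via pw₁ pt u≢w₁
  U-rooted {w₂ = w₂} (inj₂ w₁∈A′) (inj₁ pw₂) w₁≢w₂ with avoiding-port w₁∈A′ w₂
  ... | _ , _ , u≢w₂ , _ , pt = rooted-via-direct pt pw₂ u≢w₂
  U-rooted {w₁} {w₂} w₁∈U@(inj₂ w₁∈A′) w₂∈U@(inj₂ w₂∈A′) w₁≢w₂ with avoiding-port w₁∈A′ w₁
  ... | u₁ , _ , _ , _ , pt₁ with avoiding-port w₂∈A′ u₁
  ...   | _ , _ , u₂≢u₁ , _ , pt₂ = rooted-via pt₁ pt₂ (u₂≢u₁ ∘ sym) (inj₂ w₁≢w₂) (proj₁ w₁∈A′) (proj₁ w₂∈A′)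
    (port-base∉U pt₁ w₂∈U) (port-base∉U pt₂ w₁∈U)

  A′-base : ∀ {w b} → InA′ w → InB⁺ b → h b w ≡ true → ∃ λ u → NonNbr u b
  A′-base (pw , _) (inj₁ refl)        b~w = contradiction refl (true≢false b~w pw)
  A′-base {w} (pw , _) (inj₂ (inj₁ refl)) b~w = contradiction refl (true≢false (trans (twins w) b~w) pw)
  A′-base _        (inj₂ (inj₂ u≁b)) b~w = u≁b

  -- Both root trails end at `w` and must enter it by different edges; the two neighbours in `B⁺`
  -- supply them. If `w` is in `A` and `p` equals `q`, one of the neighbours is not `p` and yields a
  -- port.
  double-rooted : ∀ {w} → InU w → Double w → Rooted w w
  double-rooted {w} (inj₁ pw) (b , c , b≢c , (b∈B⁺ , b~w) , (c∈B⁺ , c~w)) with p ≟ q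
  ... | no p≢q   = rooted-direct pw pw (inj₂ p≢q)
  ... | yes refl = through b∈B⁺ c∈B⁺
    where
    by-port : ∀ {x} → (∃ λ u → NonNbr u x) → h x w ≡ true → Rooted w w
    by-port (u , u≁x) x~w = rooted-direct-via pw (toPort u≁x x~w) (Port.u≢w (toPort u≁x x~w))
    through : InB⁺ b → InB⁺ c → Rooted w w
    through (inj₂ (inj₂ u≁b))  _                  = by-port u≁b b~w
    through _                  (inj₂ (inj₂ u≁c))  = by-port u≁c c~w
    through (inj₁ refl)        (inj₁ refl)        = contradiction refl b≢c
    through (inj₁ refl)        (inj₂ (inj₁ refl)) = contradiction refl b≢c
    through (inj₂ (inj₁ refl)) (inj₁ refl)        = contradiction refl b≢c
    through (inj₂ (inj₁ refl)) (inj₂ (inj₁ refl)) = contradiction refl b≢c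
  double-rooted {w} w∈U@(inj₂ w∈A′) (b , c , b≢c , (b∈B⁺ , b~w) , (c∈B⁺ , c~w))
    with A′-base w∈A′ b∈B⁺ b~w | A′-base w∈A′ c∈B⁺ c~w
  ... | u , u≁b | v , v≁c with u ≟ v
  ...   | no u≢v   = both (toPort u≁b b~w) (toPort v≁c c~w) u≢v b≢c
    where
    both : ∀ {u b v c} → Port u b w → Port v c w → u ≢ v → b ≢ c → Rooted w w
    both pt₁ pt₂ u≢v b≢c = rooted-via pt₁ pt₂ u≢v (inj₁ b≢c) (proj₁ w∈A′) (proj₁ w∈A′) (Port.b≢w pt₁) (Port.b≢w pt₂)
  -- `rooted-via` wants different first inner vertices, so a port avoiding `u` replaces one trail;
  -- it is paired with `b` or `c`, whichever is not its base.
  ...   | yes refl with avoiding-port w∈A′ u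
  ...     | x , d , x≢u , _ , pt with d ≟ b
  ...       | no d≢b   = rooted-via pt (toPort u≁b b~w) x≢u (inj₁ d≢b) (proj₁ w∈A′) (proj₁ w∈A′) (Port.b≢w pt) (adjacent⇒≢ simple b~w)
  ...       | yes refl = rooted-via pt (toPort v≁c c~w) x≢u (inj₁ b≢c) (proj₁ w∈A′) (proj₁ w∈A′) (Port.b≢w pt) (adjacent⇒≢ simple c~w)

  U-clique : ∀ {w₁ w₂} → InU w₁ → InU w₂ → w₁ ≢ w₂ → h w₁ w₂ ≡ true
  U-clique w₁∈U w₂∈U w₁≢w₂ = rooted⇒adjacent (U-rooted w₁∈U w₂∈U w₁≢w₂) w₁≢w₂

  ∉U⇒∉A : ∀ {z} → ¬ InU z → h p z ≡ false
  ∉U⇒∉A z∉U = nonadjacent λ pz → z∉U (inj₁ pz)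

  ∉U⇒≢ : ∀ {w z} → InU w → ¬ InU z → w ≢ z
  ∉U⇒≢ w∈U z∉U refl = z∉U w∈U

  outside-independent : ∀ {w₁ w₂ z₁ z₂} → Rooted w₁ w₂ → InU w₁ → InU w₂ → ¬ InU z₁ → ¬ InU z₂ →
    h w₁ z₁ ≡ false → h w₂ z₂ ≡ false → h z₁ z₂ ≡ false
  outside-independent r w₁∈U w₂∈U z₁∉U z₂∉U = rooted⇒independent r (∉U⇒∉A z₁∉U) (∉U⇒∉A z₂∉U)
    (∉U⇒≢ w₁∈U z₁∉U) (∉U⇒≢ w₁∈U z₂∉U) (∉U⇒≢ w₂∈U z₁∉U) (∉U⇒≢ w₂∈U z₂∉U)

  -- A vertex with two non-neighbours in `A` is by itself the base of two ports to each of its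
  -- neighbours outside `A`.
  B-nbr∈U : ∀ {b v} → InB b → h b v ≡ true → InU v
  B-nbr∈U (inj₁ refl)        b~v = inj₁ b~v
  B-nbr∈U {v = v} (inj₂ (inj₁ refl)) b~v = inj₁ (trans (twins v) b~v)
  B-nbr∈U {b} {v} (inj₂ (inj₂ (u₁ , u₂ , u₁≢u₂ , n₁ , n₂))) b~v with h p v in pv
  ... | true  = inj₁ refl
  ... | false = inj₂ (refl , u₁ , b , u₂ , b , u₁≢u₂ , (n₁ , b~v) , (n₂ , b~v))

  SoleNonNbr : Fin n → Fin n → Set
  SoleNonNbr t z = h t z ≡ false × (∀ w → InU w → h w z ≡ false → w ≡ t)

  -- An edge z₁ z₂ outside U both of whose ends have t as their only non-neighbour
  -- in U, where t itself can be reached in only one way: alternating walks that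
  -- go around t z₁ z₂ t cannot be turned into trails.
  Blossom : Fin n → Set
  Blossom t = InU t × ¬ Double t × ∃ λ z₁ → ∃ λ z₂ →
    h z₁ z₂ ≡ true × (¬ InU z₁ × SoleNonNbr t z₁) × (¬ InU z₂ × SoleNonNbr t z₂)

  abstract
    blossom? : ∀ t → Dec (Blossom t)
    blossom? t = inU? t ×-dec ¬? (double? t) ×-dec any? λ z₁ → any? λ z₂ →
      (h z₁ z₂ Bool.≟ true) ×-dec (¬? (inU? z₁) ×-dec sole? z₁) ×-dec (¬? (inU? z₂) ×-dec sole? z₂)
      where
      sole? : ∀ z → Dec (SoleNonNbr t z)
      sole? z = (h t z Bool.≟ false) ×-dec all? λ w → inU? w →-dec (h w z Bool.≟ false) →-dec (w ≟ t)

  -- Two blossoms would be joined by the middle trail `s`, `y₂`, `y₁`, `z₁`, `z₂`, `t`. Its central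
  -- pair is a non-edge by `outside-independent`, and soleness keeps the `y` and the `z` apart.
  blossom-unique : ∀ {s t} → Blossom s → Blossom t → s ≡ t
  blossom-unique {s} {t} (s∈U , _ , y₁ , y₂ , y₁~y₂ , (y₁∉U , s≁y₁ , sole₁) , (y₂∉U , s≁y₂ , sole₂))
                         (t∈U , _ , z₁ , z₂ , z₁~z₂ , (z₁∉U , t≁z₁ , sole₃) , (z₂∉U , t≁z₂ , sole₄)) with s ≟ t
  ... | yes s≡t = s≡t
  ... | no s≢t  = ⊥-elim (no-middle r (five apart (distinct sole₂ t≁z₁) (distinct sole₂ t≁z₂) (distinct sole₁ t≁z₁) (distinct sole₁ t≁z₂)
      (Rooted.near₁ r y₂ s≁y₂)
      (trans (far y₂∉U y₁∉U) (trans (symm y₂ y₁) y₁~y₂))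
      (trans (far y₁∉U z₁∉U) (outside-independent r s∈U t∈U y₁∉U z₁∉U s≁y₁ t≁z₁))
      (trans (far z₁∉U z₂∉U) z₁~z₂)
      (Rooted.near₂ r z₂ t≁z₂)))
    where
    r : Rooted s t
    r = U-rooted s∈U t∈U s≢t
    far : ∀ {i j} → ¬ InU i → ¬ InU j → Rooted.K r i j ≡ h i j
    far i∉U j∉U = Rooted.far r _ _ (∉U⇒∉A i∉U) (∉U⇒∉A j∉U)
      (∉U⇒≢ s∈U i∉U) (∉U⇒≢ s∈U j∉U) (∉U⇒≢ t∈U i∉U) (∉U⇒≢ t∈U j∉U)
    distinct : ∀ {y z} → (∀ w → InU w → h w y ≡ false → w ≡ s) → h t z ≡ false → y ≢ z
    distinct sole t≁z refl = s≢t (sym (sole t t∈U t≁z))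
    apart : ∀ {w} → w ≡ s ⊎ w ≡ t → (w ≢ y₂ × w ≢ y₁) × (w ≢ z₁ × w ≢ z₂)
    apart (inj₁ refl) = (∉U⇒≢ s∈U y₂∉U , ∉U⇒≢ s∈U y₁∉U) , (∉U⇒≢ s∈U z₁∉U , ∉U⇒≢ s∈U z₂∉U)
    apart (inj₂ refl) = (∉U⇒≢ t∈U y₂∉U , ∉U⇒≢ t∈U y₁∉U) , (∉U⇒≢ t∈U z₁∉U , ∉U⇒≢ t∈U z₂∉U)

  Incomplete : Fin n → Set
  Incomplete v = ∃ λ w → InU w × ¬ Blossom w × h w v ≡ false

  abstract
    incomplete? : ∀ v → Dec (Incomplete v)
    incomplete? v = any? λ w → inU? w ×-dec ¬? (blossom? w) ×-dec (h w v Bool.≟ false)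

  -- Different missed vertices, or a common one that is `Double`, give a middle trail of length 3 as
  -- soon as `y` and `z` are adjacent. Otherwise the edge `y z` would make the common missed vertex
  -- a blossom, against the choice in `Incomplete`.
  incomplete-independent : ∀ {y z} → ¬ InU y → ¬ InU z → Incomplete y → Incomplete z → h y z ≡ false
  incomplete-independent {y} {z} y∉U z∉U (v , v∈U , v-plain , v≁y) (w , w∈U , w-plain , w≁z) with v ≟ w
  ... | no v≢w   = outside-independent (U-rooted v∈U w∈U v≢w) v∈U w∈U y∉U z∉U v≁y w≁z
  ... | yes refl with double? v
  ...   | yes double = outside-independent (double-rooted v∈U double) v∈U v∈U y∉U z∉U v≁y w≁z
  ...   | no simple-v = nonadjacent λ y~z → v-plain (v∈U , simple-v , y , z , y~z ,
      (y∉U , v≁y , λ x x∈U x≁y → sole x x∈U λ x≢v →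
        true≢false y~z (outside-independent (U-rooted x∈U v∈U x≢v) x∈U v∈U y∉U z∉U x≁y w≁z) refl) ,
      (z∉U , w≁z , λ x x∈U x≁z → sole x x∈U λ x≢v →
        true≢false y~z (outside-independent (U-rooted v∈U x∈U (x≢v ∘ sym)) v∈U x∈U y∉U z∉U v≁y x≁z) refl))
    where
    sole : ∀ x → InU x → ¬ (x ≢ v) → x ≡ v
    sole x x∈U ¬x≢v with x ≟ v
    ... | yes x≡v = x≡v
    ... | no x≢v  = contradiction x≢v ¬x≢v

  -- The partition and its obstruction

  data Class (i : Fin n) : Part → Set where
    base     : InB i → Class i B
    clique   : InU i → ¬ Blossom i → Class i U
    low      : ¬ InB i → ¬ InU i → Incomplete i → Class i V
    -- Taking the blossom out of the clique is what makes `U` completely joined to `R` and `W`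
    -- independent.
    blossom  : Blossom i → Class i R
    complete : ¬ InB i → ¬ InU i → ¬ Incomplete i → Class i R

  abstract
    classify : ∀ i → ∃ (Class i)
    classify i with inB? i | inU? i | blossom? i | incomplete? i
    ... | yes i∈B | _       | _     | _       = B , base i∈B
    ... | no _    | yes _   | yes b | _       = R , blossom b
    ... | no _    | yes i∈U | no ¬b | _       = U , clique i∈U ¬b
    ... | no i∉B  | no i∉U  | _     | yes inc = V , low i∉B i∉U inc
    ... | no i∉B  | no i∉U  | _     | no ¬inc = R , complete i∉B i∉U ¬inc

  part : Fin n → Part
  part i = proj₁ (classify i)

  view : ∀ {i P} → part i ≡ P → Class i P
  view {i} refl = proj₂ (classify i)

  part-B : ∀ {i} → InB i → part i ≡ B
  part-B {i} i∈B = determined (proj₂ (classify i))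
    where
    determined : ∀ {P} → Class i P → P ≡ B
    determined (base _)                  = refl
    determined (clique i∈U _)            = contradiction i∈U (B⁺∩U (B⊆B⁺ i∈B))
    determined (low i∉B _ _)             = contradiction i∈B i∉B
    determined (blossom (i∈U , _))       = contradiction i∈U (B⁺∩U (B⊆B⁺ i∈B))
    determined (complete i∉B _ _)        = contradiction i∈B i∉B

  part-U : ∀ {i} → InU i → ¬ Blossom i → part i ≡ U
  part-U {i} i∈U ¬b = determined (proj₂ (classify i))
    where
    determined : ∀ {P} → Class i P → P ≡ U
    determined (base i∈B)         = contradiction i∈U (B⁺∩U (B⊆B⁺ i∈B))
    determined (clique _ _)       = refl
    determined (low _ i∉U _)      = contradiction i∈U i∉U
    determined (blossom b)        = contradiction b ¬b
    determined (complete _ i∉U _) = contradiction i∈U i∉U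

  U-complete-to-R : ∀ i j → part i ≡ U → part j ≡ R → h i j ≡ true
  U-complete-to-R i j i∈U j∈R with view i∈U | view j∈R
  ... | clique i∈U ¬b | blossom b@(j∈U , _) = U-clique i∈U j∈U λ { refl → ¬b b }
  ... | clique i∈U ¬b | complete _ _ ¬inc   = adjacent λ i≁j → ¬inc (i , i∈U , ¬b , i≁j)

  W-independent : ∀ i j → isW (part i) ≡ true → isW (part j) ≡ true → h i j ≡ false
  W-independent i j i∈W j∈W = independent (proj₂ (classify i)) (proj₂ (classify j)) i∈W j∈W
    where
    W⇒∉U : ∀ {k P} → Class k P → isW P ≡ true → ¬ InU k
    W⇒∉U (base k∈B)      _ = B⁺∩U (B⊆B⁺ k∈B)
    W⇒∉U (low _ k∉U _)   _ = k∉U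
    independent : ∀ {P Q} → Class i P → Class j Q → isW P ≡ true → isW Q ≡ true → h i j ≡ false
    independent (base i∈B)       cj               _ wj = nonadjacent λ i~j → W⇒∉U cj wj (B-nbr∈U i∈B i~j)
    independent ci@(low _ _ _)   (base j∈B)       wi _ = nonadjacent λ i~j → W⇒∉U ci wi (B-nbr∈U j∈B (trans (symm j i) i~j))
    independent (low _ i∉U incᵢ) (low _ j∉U incⱼ) _ _  = incomplete-independent i∉U j∉U incᵢ incⱼ

  -- Neighbours of `B` lie in `InU`, so the end in `R` must be the only blossom; not being `Double`,
  -- it has at most one neighbour in `B`.
  BR-unique : ∀ b r b′ r′ → part b ≡ B → part r ≡ R → h r b ≡ true →
    part b′ ≡ B → part r′ ≡ R → h r′ b′ ≡ true → b ≡ b′ × r ≡ r′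
  BR-unique b r b′ r′ b∈B r∈R r~b b′∈B r′∈R r′~b′ with view b∈B | view r∈R | view b′∈B | view r′∈R
  ... | base b∈B | complete _ r∉U _ | _ | _ = contradiction (B-nbr∈U b∈B (trans (symm b r) r~b)) r∉U
  ... | _ | _ | base b′∈B | complete _ r′∉U _ = contradiction (B-nbr∈U b′∈B (trans (symm b′ r′) r′~b′)) r′∉U
  ... | base b∈B | blossom bl | base b′∈B | blossom bl′ with blossom-unique bl bl′
  ...   | refl with b ≟ b′
  ...     | yes b≡b′ = b≡b′ , refl
  ...     | no b≢b′  = contradiction (b , b′ , b≢b′ , (B⊆B⁺ b∈B , trans (symm b r) r~b) , (B⊆B⁺ b′∈B , trans (symm b′ r) r′~b′)) (proj₁ (proj₂ bl))

  does⇒ : ∀ {P : Set} (P? : Dec P) → does P? ≡ true → P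
  does⇒ (yes p) refl = p

  plain : Fin n → Bool
  plain j = not (does (blossom? j))

  -- If `p` and `q` differ, they make every vertex of `A` `Double`, so `A` contains no blossom; if
  -- they coincide, uniqueness leaves one. The bound `e q p` expresses both cases.
  A-blossoms : sumℕ (λ j → ⟦ h p j ⟧ * ⟦ does (blossom? j) ⟧) ≤ e q p
  A-blossoms with q ≟ p
  ... | yes _  = sum-unit (λ j → *-mono-≤ (⟦⟧≤1 (h p j)) (⟦⟧≤1 (does (blossom? j)))) λ i j 0<i 0<j →
    blossom-unique (does⇒ (blossom? i) (proj₂ (⟦⟧*⟦⟧-positive (h p i) _ 0<i))) (does⇒ (blossom? j) (proj₂ (⟦⟧*⟦⟧-positive (h p j) _ 0<j)))
  ... | no q≢p = ≤-reflexive (sum-zero none)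
    where
    none : ∀ j → ⟦ h p j ⟧ * ⟦ does (blossom? j) ⟧ ≡ 0
    none j with h p j in pj | blossom? j
    ... | false | _     = refl
    ... | true  | no _  = refl
    ... | true  | yes (_ , ¬double , _) =
      contradiction (p , q , q≢p ∘ sym , (inj₁ refl , pj) , (inj₂ (inj₁ refl) , trans (sym (twins j)) pj)) ¬double

  deg-p : deg h p ≡ D p + 1 + e q p
  deg-p = trans (degrees p) (cong (λ x → D p + x + e q p) (e-diag p))

  -- The degree of `p` in `h` exceeds `D p + 1` by `e q p`, exactly the number of blossoms that `A`
  -- may lose.
  A-plain : D p + 1 ≤ sumℕ λ j → ⟦ h p j ⟧ * ⟦ plain j ⟧
  A-plain = +-cancelʳ-≤ (e q p) _ _ (begin
    D p + 1 + e q p                                            ≡⟨ deg-p ⟨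
    deg h p                                                    ≡⟨ sum-cong-≗ split ⟩
    sumℕ (λ j → ⟦ h p j ⟧ * ⟦ plain j ⟧ + ⟦ h p j ⟧ * ⟦ does (blossom? j) ⟧) ≡⟨ sum-+ (λ j → ⟦ h p j ⟧ * ⟦ plain j ⟧) (λ j → ⟦ h p j ⟧ * ⟦ does (blossom? j) ⟧) ⟩
    plains + sumℕ (λ j → ⟦ h p j ⟧ * ⟦ does (blossom? j) ⟧)      ≤⟨ +-monoʳ-≤ plains A-blossoms ⟩
    plains + e q p                                             ∎)
    where
    open ≤-Reasoning
    plains = sumℕ λ j → ⟦ h p j ⟧ * ⟦ plain j ⟧
    split : ∀ j → ⟦ h p j ⟧ ≡ ⟦ h p j ⟧ * ⟦ plain j ⟧ + ⟦ h p j ⟧ * ⟦ does (blossom? j) ⟧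
    split j with h p j | does (blossom? j)
    ... | false | _     = refl
    ... | true  | true  = refl
    ... | true  | false = refl

  plain-A⇒U : ∀ {j} → h p j ≡ true → plain j ≡ true → part j ≡ U
  plain-A⇒U {j} pj plain-j = part-U (inj₁ pj) (not-blossom plain-j)
    where
    not-blossom : plain j ≡ true → ¬ Blossom j
    not-blossom eq b with blossom? j
    not-blossom () _ | yes _
    not-blossom _  b | no ¬b = ¬b b

  -- A vertex of `V` is not in `B`, hence misses at most one vertex of `A`; the extra unit in
  -- `A-plain` pays for it.
  V-degree : ∀ i → part i ≡ V → D p ≤ over (isU ∘ part) (λ j → ⟦ h i j ⟧)
  V-degree i i∈V with view i∈V
  ... | low i∉B i∉U _ = +-cancelʳ-≤ 1 _ _ (begin
    D p + 1                                                          ≤⟨ A-plain ⟩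
    sumℕ (λ j → ⟦ h p j ⟧ * ⟦ plain j ⟧)                             ≤⟨ sum-mono bound ⟩
    sumℕ (λ j → ⟦ isU (part j) ⟧ * ⟦ h i j ⟧ + ⟦ h p j ⟧ * ⟦ not (h i j) ⟧) ≡⟨ sum-+ (λ j → ⟦ isU (part j) ⟧ * ⟦ h i j ⟧) (λ j → ⟦ h p j ⟧ * ⟦ not (h i j) ⟧) ⟩
    dU + sumℕ (λ j → ⟦ h p j ⟧ * ⟦ not (h i j) ⟧)                    ≤⟨ +-monoʳ-≤ dU (sum-unit (λ j → *-mono-≤ (⟦⟧≤1 (h p j)) (⟦⟧≤1 (not (h i j)))) unique) ⟩
    dU + 1                                                           ∎)
    where
    open ≤-Reasoning
    dU = over (isU ∘ part) λ j → ⟦ h i j ⟧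
    bound : ∀ j → ⟦ h p j ⟧ * ⟦ plain j ⟧ ≤ ⟦ isU (part j) ⟧ * ⟦ h i j ⟧ + ⟦ h p j ⟧ * ⟦ not (h i j) ⟧
    bound j = by-cases (h p j) refl (plain j) refl (h i j)
      where
      by-cases : ∀ a → h p j ≡ a → ∀ c → plain j ≡ c → ∀ d → ⟦ a ⟧ * ⟦ c ⟧ ≤ ⟦ isU (part j) ⟧ * ⟦ d ⟧ + ⟦ a ⟧ * ⟦ not d ⟧
      by-cases false _  _     _       _     = z≤n
      by-cases true  _  false _       _     = z≤n
      by-cases true  _  true  _       false = m≤n+m 1 _
      by-cases true  pj true  plain-j true  rewrite plain-A⇒U pj plain-j = ≤-refl
    toNonNbr : ∀ j → 0 < ⟦ h p j ⟧ * ⟦ not (h i j) ⟧ → NonNbr j i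
    toNonNbr j 0<j with ⟦⟧*⟦⟧-positive _ _ 0<j
    ... | pj , i≁j = pj , trans (symm j i) (not-true i≁j) , differ pj (∉U⇒∉A i∉U)
      where
      not-true : ∀ {x} → not x ≡ true → x ≡ false
      not-true {false} _ = refl
    unique : ∀ j k → 0 < ⟦ h p j ⟧ * ⟦ not (h i j) ⟧ → 0 < ⟦ h p k ⟧ * ⟦ not (h i k) ⟧ → j ≡ k
    unique j k 0<j 0<k with j ≟ k
    ... | yes j≡k = j≡k
    ... | no j≢k  = contradiction (inj₂ (inj₂ (j , k , j≢k , toNonNbr j 0<j , toNonNbr k 0<k))) i∉B

  Dominates : Fin n → Fin n → Set
  Dominates u i = part u ≡ U × h u p ≡ true × (∀ j → part j ≡ V → h i j ≡ true → h u j ≡ true)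

  -- By `A-plain` there are two plain vertices `u` and `v` in `A`. For a blossom `u` always
  -- dominates; for any other vertex of `R` one of the two does.
  R-dominated : 1 ≤ D p → ∀ i → part i ≡ R → ∃ λ u → Dominates u i
  R-dominated 1≤Dp i i∈R
    with two-positive (λ j → ⟦ h p j ⟧ * ⟦ plain j ⟧) (λ j → *-mono-≤ (⟦⟧≤1 (h p j)) (⟦⟧≤1 (plain j)))
           (≤-trans (+-monoˡ-≤ 1 1≤Dp) A-plain)
  ... | u , v , u≢v , 0<u , 0<v with ⟦⟧*⟦⟧-positive _ _ 0<u | ⟦⟧*⟦⟧-positive _ _ 0<v
  ...   | pu , plain-u | pv , plain-v = dominating (view i∈R)
    where
    V-nonNbr : ∀ {w j} → h p w ≡ true → part j ≡ V → h w j ≡ false → ¬ InB j × NonNbr w j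
    V-nonNbr pw j∈V w≁j with view j∈V
    ... | low j∉B j∉U _ = j∉B , pw , w≁j , differ pw (∉U⇒∉A j∉U)

    dominates : ∀ {w} → h p w ≡ true → plain w ≡ true →
      (∀ j → part j ≡ V → h i j ≡ true → h w j ≡ false → ⊥) → ∃ λ u → Dominates u i
    dominates {w} pw plain-w noV = w , plain-A⇒U pw plain-w , trans (symm w p) pw , λ j j∈V i~j → adjacent (noV j j∈V i~j)

    dominating : Class i R → ∃ λ u → Dominates u i
    dominating (blossom (i∈U , ¬double , _)) = dominates pu plain-u (clash i∈U)
      where
      -- `j` would be one of two neighbours of the blossom in `B⁺`, the other being `p` or a base of
      -- one of its two ports. Were both bases equal to `j`, then `j` would lie in `B`.
      clash : InU i → ∀ j → part j ≡ V → h i j ≡ true → h u j ≡ false → ⊥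
      clash i∈U j j∈V i~j u≁j with V-nonNbr pu j∈V u≁j | i∈U
      ... | j∉B , n | inj₁ pi = ¬double (p , j , (λ { refl → j∉B (inj₁ refl) }) , (inj₁ refl , pi) , (inj₂ (inj₂ (u , n)) , trans (symm j i) i~j))
      ... | j∉B , n | inj₂ (_ , u₁ , b₁ , u₂ , b₂ , u₁≢u₂ , (n₁ , b₁~i) , (n₂ , b₂~i)) with b₁ ≟ j | b₂ ≟ j
      ...   | no b₁≢j  | _        = ¬double (b₁ , j , b₁≢j , (inj₂ (inj₂ (u₁ , n₁)) , b₁~i) , (inj₂ (inj₂ (u , n)) , trans (symm j i) i~j))
      ...   | _        | no b₂≢j  = ¬double (b₂ , j , b₂≢j , (inj₂ (inj₂ (u₂ , n₂)) , b₂~i) , (inj₂ (inj₂ (u , n)) , trans (symm j i) i~j))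
      ...   | yes refl | yes refl = j∉B (inj₂ (inj₂ (u₁ , u₂ , u₁≢u₂ , n₁ , n₂)))
    -- Were neither u nor v good, i would have two ports and lie in U.
    dominating (complete _ i∉U _)
      with any? (λ j → (isV (part j) Bool.≟ true) ×-dec (h i j Bool.≟ true) ×-dec (h u j Bool.≟ false))
    ... | no none = dominates pu plain-u λ j j∈V i~j u≁j → none (j , cong isV j∈V , i~j , u≁j)
    ... | yes (k , k∈V , i~k , u≁k) = dominates pv plain-v λ j j∈V i~j v≁j →
      i∉U (inj₂ (∉U⇒∉A i∉U , u , k , v , j , u≢v ,
        (proj₂ (V-nonNbr pu (toV k∈V) u≁k) , trans (symm k i) i~k) , (proj₂ (V-nonNbr pv j∈V v≁j) , trans (symm j i) i~j)))
      where
      toV : ∀ {P} → isV P ≡ true → P ≡ V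
      toV {V} _ = refl

  obstruction : ∀ {c₁ c₂} → 0 < c₂ → (∀ i → D i ≤ c₁) → (∀ i → c₂ ≤ D i) → Obstruction h D c₁ c₂ p q part
  obstruction 0<c₂ upper lower = record
    { simple  = simple
    ; degrees = degrees
    ; upper   = upper
    ; lower   = lower
    ; p∈B     = part-B (inj₁ refl)
    ; q∈B     = part-B (inj₂ (inj₁ refl))
    ; UU      = UU
    ; UR      = U-complete-to-R
    ; WW      = W-independent
    ; BR      = BR-unique
    ; VU      = λ i i∈V → ≤-trans (lower p) (V-degree i i∈V)
    ; R-domin = R-dominated (≤-trans 0<c₂ (lower p))
    }
    where
    UU : ∀ i j → part i ≡ U → part j ≡ U → i ≢ j → h i j ≡ true
    UU i j i∈U j∈U i≢j with view i∈U | view j∈U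
    ... | clique i∈U _ | clique j∈U _ = U-clique i∈U j∈U i≢j

-- Encoding realizations

fromAdj : Adj n → Neighbourhoods n
fromAdj g = tabulate λ i → tabulate (g i)

adj-fromAdj : ∀ (g : Adj n) i j → adj (fromAdj g) i j ≡ g i j
adj-fromAdj g i j = trans (cong (λ s → lookup s j) (lookup∘tabulate (λ i → tabulate (g i)) i)) (lookup∘tabulate (g i) j)

fromAdj-adj : ∀ {g : Adj n} (G : Neighbourhoods n) → (∀ i j → g i j ≡ adj G i j) → fromAdj g ≡ G
fromAdj-adj G g≗G = trans
  (tabulate-cong λ i → trans (tabulate-cong (g≗G i)) (tabulate∘lookup (lookup G i))) (tabulate∘lookup G)

fromAdj-realizes : ∀ {g : Adj n} {D} → Simple g → (∀ i → deg g i ≡ D i) → IsRealization D (fromAdj g)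
fromAdj-realizes {g = g} simple deg≡D = mkRealization
  (mkSimple
    (λ i j i~j → lookup⇒[]= i _ (trans (adj-fromAdj g j i) (trans (symm j i) (trans (sym (adj-fromAdj g i j)) ([]=⇒lookup i~j)))))
    (λ i i~i → true≢false ([]=⇒lookup i~i) (trans (adj-fromAdj g i i) (irr i)) refl))
  λ i → trans (∣∣≡sum (lookup (fromAdj g) i)) (trans (deg-cong (adj-fromAdj g) i) (deg≡D i))
  where open Simple simple

realization-degrees : ∀ {D} {G : Neighbourhoods n} → IsRealization D G → ∀ i → deg (adj G) i ≡ D i
realization-degrees {G = G} (mkRealization _ degrees) i = trans (sym (∣∣≡sum (lookup G i))) (degrees i)

module _ {A B C : Set} (f : A → B → C) where

  length-cartesianProductWith : ∀ xs ys → length (cartesianProductWith f xs ys) ≡ length xs * length ys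
  length-cartesianProductWith []       ys = refl
  length-cartesianProductWith (x ∷ xs) ys = trans (length-++ (map (f x) ys))
    (cong₂ _+_ (length-map (f x) ys) (length-cartesianProductWith xs ys))

length-allVecs : ∀ {A : Set} (xs : List A) m → length (allVecs xs m) ≡ length xs ^ m
length-allVecs xs zero    = refl
length-allVecs xs (suc m) = trans (length-cartesianProductWith _∷_ xs (allVecs xs m)) (cong (length xs *_) (length-allVecs xs m))

lookup-injective : ∀ {A : Set} {xs : List A} → Unique xs → ∀ {i j} → List.lookup xs i ≡ List.lookup xs j → i ≡ j
lookup-injective (_ ∷ _)   {zero}  {zero}  _  = refl
lookup-injective (x≢ ∷ _)  {zero}  {suc j} eq = contradiction eq (All.lookup x≢ (∈-lookup j))
lookup-injective (x≢ ∷ _)  {suc i} {zero}  eq = contradiction (sym eq) (All.lookup x≢ (∈-lookup i))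
lookup-injective (_ ∷ u)   {suc i} {suc j} eq = cong suc (lookup-injective u eq)

unique-⊆⇒length≤ : ∀ {A : Set} {xs ys : List A} → Unique xs → (∀ {x} → x ∈ xs → x ∈ ys) → length xs ≤ length ys
unique-⊆⇒length≤ {A} {xs} unique xs⊆ys = injective⇒≤ {f = λ i → index (xs⊆ys (∈-lookup {xs = xs} i))}
  λ {i} {j} eq → lookup-injective unique (index-injective (setoid A) (xs⊆ys (∈-lookup i)) (xs⊆ys (∈-lookup j)) eq)

-- Toggling twice is the identity, so each realization of `D′` is the image of its code and the
-- realization of `D` reached by it. The repetition-free list `𝓖 D′` is thus covered by the images
-- of all such combinations.
∣𝓖∣≤codes : ∀ {D D′ : Vector ℕ n} (codes : List (List (Fin n × Fin n))) →
  (∀ {h} → Simple h → (∀ i → deg h i ≡ D′ i) → ∃ λ L → L ∈ codes × (∀ i → deg (toggles L h) i ≡ D i)) →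
  ∣𝓖∣ D′ ≤ length codes * ∣𝓖∣ D
∣𝓖∣≤codes {n} {D} {D′} codes decode = ≤-trans
  (unique-⊆⇒length≤ (𝓖-unique D′) covered)
  (≤-reflexive (length-cartesianProductWith encode codes (𝓖 D)))
  where
  encode : List (Fin n × Fin n) → Neighbourhoods n → Neighbourhoods n
  encode L G = fromAdj (toggles L (adj G))

  covered : ∀ {H} → H ∈ 𝓖 D′ → H ∈ cartesianProductWith encode codes (𝓖 D)
  covered {H} H∈𝓖 = subst (_∈ cartesianProductWith encode codes (𝓖 D)) back
    (∈-cartesianProductWith⁺ encode L∈codes (𝓖-complete D (fromAdj-realizes (toggles-simple L simple) deg≡D)))
    where
    realizes = 𝓖-sound D′ H∈𝓖
    simple = adj-simple (IsRealization.isSimpleGraph realizes)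
    decoded = decode simple (realization-degrees realizes)
    L = proj₁ decoded
    L∈codes = proj₁ (proj₂ decoded)
    deg≡D = proj₂ (proj₂ decoded)
    G = fromAdj (toggles L (adj H))
    back : encode L G ≡ H
    back = fromAdj-adj H λ i j →
      trans (toggles-cong L (adj-fromAdj (toggles L (adj H))) i j) (toggles-involutive L (adj H) i j)

trailᵛ : (p q : Fin n) → Vec (Fin n) 10 → List (Fin n × Fin n)
trailᵛ p q (u₁ ∷ b₁ ∷ w₁ ∷ z₁ ∷ z₂ ∷ z₃ ∷ z₄ ∷ w₂ ∷ b₂ ∷ u₂ ∷ []) = trail p q u₁ b₁ w₁ z₁ z₂ z₃ z₄ w₂ b₂ u₂

hingeᵛ : (p q : Fin n) → Vec (Fin n) 11 → List (Fin n × Fin n)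
hingeᵛ p q (s ∷ v) = (q , s) ∷ (s , p) ∷ trailᵛ p p v

codes : (p q : Fin n) → List (List (Fin n × Fin n))
codes {n} p q = map (trailᵛ p q) (allVecs (allFin n) 10) ++ map (hingeᵛ p q) (allVecs (allFin n) 11)

∈-allVecs : ∀ {m} (v : Vec (Fin n) m) → v ∈ allVecs (allFin n) m
∈-allVecs = allVecs-complete _ ∈-allFin

length-codes : ∀ (p q : Fin n) → length (codes p q) ≡ n ^ 10 + n ^ 11
length-codes {n} p q = trans (length-++ (map (trailᵛ p q) (allVecs (allFin n) 10)))
  (cong₂ _+_ (length-all (trailᵛ p q)) (length-all (hingeᵛ p q)))
  where
  length-all : ∀ {m} (f : Vec (Fin n) m → List (Fin n × Fin n)) → length (map f (allVecs (allFin n) m)) ≡ n ^ m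
  length-all {m} f = trans (length-map f (allVecs (allFin n) m))
    (trans (length-allVecs (allFin n) m) (cong (_^ m) (length-tabulate {n = n} (λ i → i))))

-- From realizations of D + e_p + e_q to realizations of D

module Decode {c₁ c₂ : ℕ} (0<c₂ : 0 < c₂) (c₂≤c₁ : c₂ ≤ c₁) (c₁<n : c₁ < n) {D : Vector ℕ n}
  (even : 2 ∣ sumℕ D) (Σ≤ : sumℕ D ≤ n * c₁) (≤Σ : n * c₂ ≤ sumℕ D)
  (upper : ∀ i → D i ≤ c₁) (lower : ∀ i → c₂ ≤ D i)
  (fg : FullyGraphic (𝔻 n (sumℕ D) c₁ c₂)) where

  -- Exhaustive search makes the dichotomy constructive: either some tuple works, or the failure of
  -- all of them is the hypothesis `stuck` from which the obstruction is built.
  twin-trail : ∀ {h p q} → Simple h → (∀ i → deg h i ≡ D i + e p i + e q i) → (∀ j → h p j ≡ h q j) →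
    ∃ λ v → ∀ i → deg (toggles (trailᵛ p q v) h) i ≡ D i
  twin-trail {h} {p} {q} simple degrees twins
    with Any.any? (λ v → all? λ i → deg (toggles (trailᵛ p q v) h) i ℕ.≟ D i) (allVecs (allFin n) 10)
  ... | yes found = Any.lookup found , lookup-result found
  ... | no none = ⊥-elim (no-obstruction (S.obstruction 0<c₂ upper lower) 0<c₂ c₂≤c₁ c₁<n even Σ≤ ≤Σ fg)
    where
    module S = Stuck simple degrees twins (λ u₁ b₁ w₁ z₁ z₂ z₃ z₄ w₂ b₂ u₂ deg≡D →
      none (lose (∈-allVecs (u₁ ∷ b₁ ∷ w₁ ∷ z₁ ∷ z₂ ∷ z₃ ∷ z₄ ∷ w₂ ∷ b₂ ∷ u₂ ∷ [])) deg≡D))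

  decode : ∀ {h p q} → p ≢ q → D p ≤ D q → Simple h → (∀ i → deg h i ≡ D i + e p i + e q i) →
    ∃ λ L → L ∈ codes p q × (∀ i → deg (toggles L h) i ≡ D i)
  decode {h} {p} {q} p≢q Dp≤Dq simple degrees with h p q in p~q
  ... | true = trailᵛ p q v , ∈-++⁺ˡ (∈-map⁺ (trailᵛ p q) (∈-allVecs v)) , removed
    where
    -- Every pair of this padded trail is a loop except the last, `p q`: deleting that edge removes
    -- both surplus units.
    v = p ∷ p ∷ p ∷ p ∷ p ∷ p ∷ p ∷ q ∷ q ∷ q ∷ []
    loops : List (Fin n × Fin n)
    loops = (p , p) ∷ (p , p) ∷ (p , p) ∷ (q , q) ∷ (q , q) ∷ (q , q) ∷ (p , p) ∷ (p , p) ∷ (p , p) ∷ (p , p) ∷ []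
    same : ∀ i j → toggles loops h i j ≡ h i j
    same i j = toggles-miss loops h
      (loop-misses ∷ loop-misses ∷ loop-misses ∷ loop-misses ∷ loop-misses ∷ loop-misses ∷ loop-misses ∷ loop-misses ∷ loop-misses ∷ loop-misses ∷ [])
    removed : ∀ i → deg (toggle p q (toggles loops h)) i ≡ D i
    removed i = +-cancelʳ-≡ (e p i + e q i) _ _ (trans (sym (+-assoc _ (e p i) (e q i)))
      (trans (sym (deg-remove (toggles-simple loops simple) (trans (same p q) p~q) i))
      (trans (deg-cong {g = toggles loops h} {h} same i) (trans (degrees i) (+-assoc (D i) (e p i) (e q i))))))
  ... | false with any? (λ s → (h q s Bool.≟ true) ×-dec (h p s Bool.≟ false))
  ...   | yes (s , q~s , p≁s) = (q , s) ∷ (s , p) ∷ trailᵛ p p (proj₁ found) ,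
      ∈-++⁺ʳ _ (∈-map⁺ (hingeᵛ p q) (∈-allVecs (s ∷ proj₁ found))) , proj₂ found
    where
    g₁ g₂ : Adj n
    g₁ = toggle q s h
    g₂ = toggle s p g₁
    s≢p : s ≢ p
    s≢p refl = true≢false q~s (trans (Simple.symm simple q p) p~q) refl
    simple₁ : Simple g₁
    simple₁ = toggle-simple q s simple
    g₁sp : g₁ s p ≡ false
    g₁sp = trans (toggle-miss h (second-misses (p≢q ∘ sym) s≢p)) (trans (Simple.symm simple s p) p≁s)
    degrees₂ : ∀ i → deg g₂ i ≡ D i + e p i + e p i
    degrees₂ i = +-cancelʳ-≡ (e q i) _ _ (begin
      deg g₂ i + e q i                        ≡⟨ cong (_+ e q i) (deg-add simple₁ s≢p g₁sp i) ⟩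
      deg g₁ i + e s i + e p i + e q i        ≡⟨ rearrange (deg g₁ i) (e s i) (e p i) (e q i) ⟩
      deg g₁ i + e q i + e s i + e p i        ≡⟨ cong (_+ e p i) (deg-remove simple q~s i) ⟨
      deg h i + e p i                         ≡⟨ cong (_+ e p i) (degrees i) ⟩
      D i + e p i + e q i + e p i             ≡⟨ swap (D i + e p i) (e q i) (e p i) ⟩
      D i + e p i + e p i + e q i             ∎)
      where
      open ≡-Reasoning
      rearrange : ∀ d s p q → d + s + p + q ≡ d + q + s + p
      rearrange = solve-∀
      swap : ∀ x y z → x + y + z ≡ x + z + y
      swap = solve-∀
    -- Both surplus units now sit at `p`, so the twin condition compares `p` with itself.
    found = twin-trail {g₂} {p} {p} (toggle-simple s p simple₁) degrees₂ (λ _ → refl)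
  ...   | no none = trailᵛ p q (proj₁ found) , ∈-++⁺ˡ (∈-map⁺ (trailᵛ p q) (∈-allVecs (proj₁ found))) , proj₂ found
    where
    q≤p : ∀ j → ⟦ h q j ⟧ ≤ ⟦ h p j ⟧
    q≤p j with h q j in q~j | h p j in p~j
    ... | false | _     = z≤n
    ... | true  | true  = ≤-refl
    ... | true  | false = contradiction (j , q~j , p~j) none
    -- Here `D p ≤ D q` is used: with N(q) contained in N(p) by `q≤p`, it forces the two
    -- neighbourhoods to be equal.
    p-degree : deg h p ≤ deg h q
    p-degree = begin
      deg h p             ≡⟨ degrees p ⟩
      D p + e p p + e q p ≡⟨ cong₂ (λ x y → D p + x + y) (e-diag p) (e-off (p≢q ∘ sym)) ⟩
      D p + 1 + 0         ≡⟨ +-assoc (D p) 1 0 ⟩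
      D p + 1             ≤⟨ +-monoˡ-≤ 1 Dp≤Dq ⟩
      D q + 1             ≡⟨ +-assoc (D q) 0 1 ⟨
      D q + 0 + 1         ≡⟨ cong₂ (λ x y → D q + x + y) (e-off p≢q) (e-diag q) ⟨
      D q + e p q + e q q ≡⟨ degrees q ⟨
      deg h q             ∎
      where open ≤-Reasoning
    ⟦⟧-injective : ∀ {x y} → ⟦ x ⟧ ≡ ⟦ y ⟧ → x ≡ y
    ⟦⟧-injective {true}  {true}  _ = refl
    ⟦⟧-injective {false} {false} _ = refl
    twins : ∀ j → h p j ≡ h q j
    twins j = sym (⟦⟧-injective (sum-mono-≡ q≤p p-degree j))
    found = twin-trail simple degrees twins

  ∣𝓖∣-bound : ∀ {i j} → i ≢ j → ∣𝓖∣ (D ⊕ 1⁺⁺ i j) ≤ (n ^ 10 + n ^ 11) * ∣𝓖∣ D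
  ∣𝓖∣-bound {i} {j} i≢j = Sum.[ forward , backward ]′ (≤-total (D i) (D j))
    where
    bound : ∀ p q → (∀ {h} → Simple h → (∀ i → deg h i ≡ D i + e p i + e q i) →
        ∃ λ L → L ∈ codes p q × (∀ i → deg (toggles L h) i ≡ D i)) →
      (∀ k → (D ⊕ 1⁺⁺ i j) k ≡ D k + e p k + e q k) → ∣𝓖∣ (D ⊕ 1⁺⁺ i j) ≤ (n ^ 10 + n ^ 11) * ∣𝓖∣ D
    bound p q decode D′≡ = subst (λ l → ∣𝓖∣ (D ⊕ 1⁺⁺ i j) ≤ l * ∣𝓖∣ D) (length-codes p q)
      (∣𝓖∣≤codes (codes p q) λ simple deg≡ → decode simple λ k → trans (deg≡ k) (D′≡ k))

    forward : D i ≤ D j → ∣𝓖∣ (D ⊕ 1⁺⁺ i j) ≤ (n ^ 10 + n ^ 11) * ∣𝓖∣ D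
    forward Di≤Dj = bound i j (decode i≢j Di≤Dj) λ k → sym (+-assoc (D k) (e i k) (e j k))

    backward : D j ≤ D i → ∣𝓖∣ (D ⊕ 1⁺⁺ i j) ≤ (n ^ 10 + n ^ 11) * ∣𝓖∣ D
    backward Dj≤Di = bound j i (decode (i≢j ∘ sym) Dj≤Di) λ k →
      trans (cong (_+_ (D k)) (+-comm (e i k) (e j k))) (sym (+-assoc (D k) (e j k) (e i k)))

-- Summing the ratios

ratio-≤ : ∀ {a b N} .{{_ : NonZero b}} → a ≤ N * b → + a / b ≤ℚ + N / 1
ratio-≤ {a} {suc b} {N} a≤Nb = ℚ.toℚᵘ-cancel-≤ (ℚᵘ.≤-respˡ-≃ (ℚᵘ.≃-sym (ℚ.toℚᵘ-fromℚᵘ (mkℚᵘ (+ a) b)))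
  (ℚᵘ.≤-respʳ-≃ (ℚᵘ.≃-sym (ℚ.toℚᵘ-fromℚᵘ (mkℚᵘ (+ N) 0)))
    (*≤* (subst₂ ℤ._≤_ (sym (ℤ.*-identityʳ (+ a))) (ℤ.pos-* N (suc b)) (ℤ.+≤+ a≤Nb)))))

/1-+ : ∀ a b → + a / 1 +ℚ + b / 1 ≡ + (a + b) / 1
/1-+ a b = ℚ.toℚᵘ-injective (begin
  toℚᵘ (+ a / 1 +ℚ + b / 1)             ≈⟨ ℚ.toℚᵘ-homo-+ (+ a / 1) (+ b / 1) ⟩
  toℚᵘ (+ a / 1) +ᵘ toℚᵘ (+ b / 1)      ≈⟨ ℚᵘ.+-cong (ℚ.toℚᵘ-fromℚᵘ (mkℚᵘ (+ a) 0)) (ℚ.toℚᵘ-fromℚᵘ (mkℚᵘ (+ b) 0)) ⟩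
  mkℚᵘ (+ a) 0 +ᵘ mkℚᵘ (+ b) 0          ≈⟨ *≡* (cong₂ (λ x y → (x ℤ.+ y) ℤ.* + 1) (ℤ.*-identityʳ (+ a)) (ℤ.*-identityʳ (+ b))) ⟩
  mkℚᵘ (+ (a + b)) 0                    ≈⟨ ℚ.toℚᵘ-fromℚᵘ (mkℚᵘ (+ (a + b)) 0) ⟨
  toℚᵘ (+ (a + b) / 1)                  ∎)
  where open ℚᵘ.≃-Reasoning

sumℚ-≤ : ∀ {m} {f : Fin m → ℚ} N → (∀ i → f i ≤ℚ + N / 1) → sumℚ f ≤ℚ + (m * N) / 1
sumℚ-≤ {zero}  N f≤N = ℚ.≤-refl
sumℚ-≤ {suc m} N f≤N = ℚ.≤-trans (ℚ.+-mono-≤ (f≤N zero) (sumℚ-≤ N (f≤N ∘ suc))) (ℚ.≤-reflexive (/1-+ N (m * N)))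

if-≤ : ∀ {P : Set} (P? : Dec P) {x y : ℚ} → (P → x ≤ℚ y) → 0ℚ ≤ℚ y → (if does P? then x else 0ℚ) ≤ℚ y
if-≤ (yes p) x≤y 0≤y = x≤y p
if-≤ (no _)  x≤y 0≤y = 0≤y

-- The zero entries with `i ≥ j` are bounded by `N` too, which gives the crude factor `n * n`.
∂⁺⁺-≤ : ∀ {D : Vector ℕ n} N (g : Graphic D) → (∀ {i j} → i ≢ j → ∣𝓖∣ (D ⊕ 1⁺⁺ i j) ≤ N * ∣𝓖∣ D) →
  ∂⁺⁺ D g ≤ℚ + (n * (n * N)) / 1
∂⁺⁺-≤ {n} {D} N g bound = sumℚ-≤ (n * N) λ i → sumℚ-≤ N λ j → if-≤ (i Fin.<? j)
  (λ i<j → ratio-≤ {∣𝓖∣ (D ⊕ 1⁺⁺ i j)} {∣𝓖∣ D} {N} {{graphic⇒∣𝓖∣≢0 D g}} (bound {i} {j} λ { refl → Fin.<-irrefl refl i<j }))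
  (ratio-≤ {0} {1} {N} z≤n)

theorem1p3 : (n c₁ c₂ : ℕ) → 0 < c₂ → c₂ ≤ c₁ → c₁ < n →
    (Σ : ℕ) → 0 < Σ → 2 ∣ Σ → Σ ≤ n * c₁ → n * c₂ ≤ Σ →
    (fg : FullyGraphic (𝔻 n Σ c₁ c₂)) →
    (D : Vector ℕ n) → (D∈𝔻 : 𝔻 n Σ c₁ c₂ D) →
    ∂⁺⁺ D (fg D D∈𝔻) ≤ℚ (+ (3 * n ^ 13)) / 1
theorem1p3 n c₁ c₂ 0<c₂ c₂≤c₁ c₁<n Σ 0<Σ 2∣Σ Σ≤ ≤Σ fg D D∈𝔻 = ℚ.≤-trans
  (∂⁺⁺-≤ (n ^ 10 + n ^ 11) (fg D D∈𝔻) (λ {i} {j} → bound total Σ≤ ≤Σ 2∣Σ fg {i} {j}))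
  (ratio-≤ {n * (n * (n ^ 10 + n ^ 11))} {1} {3 * n ^ 13} (begin
    n * (n * (n ^ 10 + n ^ 11))   ≡⟨ cong (n *_) (*-distribˡ-+ n (n ^ 10) (n ^ 11)) ⟩
    n * (n ^ 11 + n ^ 12)         ≡⟨ *-distribˡ-+ n (n ^ 11) (n ^ 12) ⟩
    n ^ 12 + n ^ 13               ≤⟨ +-monoˡ-≤ (n ^ 13) (m≤n*m (n ^ 12) n {{>-nonZero 0<n}}) ⟩
    n ^ 13 + n ^ 13               ≤⟨ +-monoʳ-≤ (n ^ 13) (m≤m+n (n ^ 13) (n ^ 13 + 0)) ⟩
    3 * n ^ 13                    ≡⟨ *-identityʳ (3 * n ^ 13) ⟨
    3 * n ^ 13 * 1                ∎))
  where
  open ≤-Reasoning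
  open 𝔻 D∈𝔻
  0<n : 0 < n
  0<n = ≤-trans z<s c₁<n
  -- `Decode` speaks of `sumℕ D`; a variable sum lets the equation `total` be matched with `refl`.
  bound : ∀ {Σ} → sumℕ D ≡ Σ → Σ ≤ n * c₁ → n * c₂ ≤ Σ → 2 ∣ Σ → FullyGraphic (𝔻 n Σ c₁ c₂) →
    ∀ {i j} → i ≢ j → ∣𝓖∣ (D ⊕ 1⁺⁺ i j) ≤ (n ^ 10 + n ^ 11) * ∣𝓖∣ D
  bound refl Σ≤ ≤Σ 2∣Σ fg = Decode.∣𝓖∣-bound 0<c₂ c₂≤c₁ c₁<n 2∣Σ Σ≤ ≤Σ upper lower fg
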